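{- Let $G$ be a finite graph with no induced cycle whose length is divisible by three. Then $b(G)\le 1$, where $b(G)=\sum_{i}\tilde{b}_i(I(G))$ is the total reduced Betti number of the independence complex of $G$.
   Context: For a finite graph $G$, the independence complex $I(G)$ is the simplicial complex on $V(G)$ whose faces are the independent sets of $G$. $\tilde{b}_i(I(G))$ denotes the $i$-th reduced Betti number of $I(G)$, i.e. the dimension of the $i$-th reduced homology group (rational coefficients), and $b(G)=\sum_i \tilde{b}_i(I(G))$. -}

module Defs where

open import Data.Bool using (Bool; true; false; not; _∧_; if_then_else_)
open import Data.Nat using (ℕ; zero; suc; _∸_; _≤_; _⊔_)
import Data.Nat as ℕ
open import Data.Fin using (Fin; toℕ)
import Data.Fin as Fin
open import Data.List using (List; []; _∷_; map; _++_; length; filterᵇ; upTo; foldr)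
open import Data.Bool.ListAction using (all; any)
open import Data.Nat.ListAction using (sum)
open import Data.List.Properties using (≡-dec)
open import Data.Product using (_×_; _,_)
open import Data.Sum using (_⊎_)
open import Data.Rational using (ℚ; 0ℚ; 1ℚ; _-_; _*_)
import Data.Rational.Properties as ℚP
open import Relation.Nullary.Decidable using (does)
open import Relation.Binary.PropositionalEquality using (_≡_)
open import Function.Bundles using (_⇔_)
open import Function.Definitions using (Injective)

record Graph (n : ℕ) : Set where
  field
    adj    : Fin n → Fin n → Bool
    sym    : ∀ u v → adj u v ≡ adj v u
    irrefl : ∀ v → adj v v ≡ false
open Graph public

CycAdj : (k : ℕ) → Fin k → Fin k → Set
CycAdj k i j =
  (suc (toℕ i) ≡ toℕ j) ⊎ (suc (toℕ j) ≡ toℕ i) ⊎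
  ((suc (toℕ i) ≡ k) × (toℕ j ≡ 0)) ⊎ ((suc (toℕ j) ≡ k) × (toℕ i ≡ 0))

record InducedCycle {n : ℕ} (G : Graph n) (k : ℕ) : Set where
  field
    length≥3 : 3 ≤ k
    vert     : Fin k → Fin n
    inj      : Injective _≡_ _≡_ vert
    induced  : ∀ i j → (adj G (vert i) (vert j) ≡ true) ⇔ CycAdj k i j

-- Independence complex: faces are independent sets, represented as
-- strictly increasing lists of vertices.

subsets : (n : ℕ) → List (List (Fin n))
subsets zero    = [] ∷ []
subsets (suc n) = map (map Fin.suc) (subsets n) ++ map (λ σ → Fin.zero ∷ map Fin.suc σ) (subsets n)

independent : ∀ {n} → Graph n → List (Fin n) → Bool
independent G []       = true
independent G (x ∷ xs) = all (λ y → not (adj G x y)) xs ∧ independent G xs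

-- faces of I(G) with exactly s vertices (i.e. of dimension s - 1);
-- s = 0 gives the empty face
faces : ∀ {n} → Graph n → ℕ → List (List (Fin n))
faces {n} G s = filterᵇ (λ σ → does (length σ ℕ.≟ s) ∧ independent G σ) (subsets n)

altSum : List ℚ → ℚ
altSum []       = 0ℚ
altSum (q ∷ qs) = q - altSum qs

picks : {A : Set} → List A → List (A × List A)
picks []       = []
picks (x ∷ xs) = (x , xs) ∷ map (λ { (y , ys) → (y , x ∷ ys) }) (picks xs)

choose : {A : Set} → ℕ → List A → List (List A)
choose zero    _        = [] ∷ []
choose (suc k) []       = []
choose (suc k) (x ∷ xs) = map (x ∷_) (choose k xs) ++ choose (suc k) xs

det : {R C : Set} → (R → C → ℚ) → List R → List C → ℚ
det e []       cs = 1ℚ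
det e (r ∷ rs) cs = altSum (map (λ { (c , cs') → e r c * det e rs cs' }) (picks cs))

isZeroℚ : ℚ → Bool
isZeroℚ q = does (q ℚP.≟ 0ℚ)

rank : {R C : Set} → (R → C → ℚ) → List R → List C → ℕ
rank e rs cs = foldr _⊔_ 0 (map (λ k →
  if any (λ rs' → any (λ cs' → not (isZeroℚ (det e rs' cs'))) (choose k cs)) (choose k rs)
  then k else 0) (upTo (suc (length cs))))

-- coefficient of τ in ∂σ = Σ_j (-1)^j [σ with its j-th vertex removed]
bdCoeff : ∀ {n} → List (Fin n) → List (Fin n) → ℚ
bdCoeff τ σ = altSum (map (λ { (_ , rest) → if does (≡-dec Fin._≟_ rest τ) then 1ℚ else 0ℚ }) (picks σ))

-- rank of ∂ : C̃_{s-1} → C̃_{s-2} (from faces with s vertices to faces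
-- with s-1 vertices); the augmentation ∂ : C̃_{-1} → 0 has rank 0
rankBd : ∀ {n} → Graph n → ℕ → ℕ
rankBd G zero    = 0
rankBd G (suc s) = rank bdCoeff (faces G s) (faces G (suc s))

-- reduced Betti number b̃_{s-1}(I(G)) = dim C̃_{s-1} - rank ∂_{s-1} - rank ∂_s
bettiBySize : ∀ {n} → Graph n → ℕ → ℕ
bettiBySize G s = (length (faces G s) ∸ rankBd G s) ∸ rankBd G (suc s)

-- b(G) = Σ_i b̃_i(I(G)), i = -1, …, n-1
totalBetti : ∀ {n} → Graph n → ℕ
totalBetti {n} G = sum (map (bettiBySize G) (upTo (suc n)))

{-# OPTIONS --safe #-}
module Submission where

-- Over 𝔽₂, where total reduced Betti numbers can only be larger than over ℚ, let W be a minimal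
-- vertex set whose independence complex has total Betti number at least 2.  By the exact sequence
-- relating W, W − v and W − N[v], the homology H of W is a plane, W − v and W − N[v] have
-- one-dimensional homology for every v, and the image of the homology of W − v in H is a line.
-- Since H has only three lines, these lines colour W with three colours.  Adjacent vertices get
-- different colours, and so do two neighbours a, b of v as soon as W − v − a − b is not acyclic.
-- Every v has two such neighbours: the grade of the homology of W − v exceeds that of W − N[v] by
-- at least 1, and by at least 2 if there are no such a and b; but at the two ends of an edge these
-- differences add up to 2.  So, if edges are oriented from colour i to colour i + 1 (mod 3), every
-- vertex has an out-neighbour, hence there are directed cycles.  They have length divisible by
-- three, and a shortest one is induced because a chord in either direction would shorten it.

open import Defs hiding (sym)
open import Data.Bool using (Bool; true; false; not; _∧_; _∨_; _xor_; if_then_else_)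
open import Data.Bool.ListAction using (all; any)
import Data.Bool.Properties as 𝔹
open import Data.Empty using (⊥; ⊥-elim)
open import Data.Fin using (Fin; zero; suc)
import Data.Fin as Fin
import Data.Fin.Properties as Finₚ
open import Data.Fin.Subset using (∣_∣)
open import Data.Fin.Subset.Properties using (p⊂q⇒∣p∣<∣q∣)
open import Data.Integer using (ℤ; +_; -[1+_])
import Data.Integer as ℤ
import Data.Integer.Properties as ℤₚ
import Data.Integer.Tactic.RingSolver as ℤ-Solver
open import Data.List using (List; []; _∷_; _++_; map; length; foldr; filter; filterᵇ; allFin)
open import Data.List.Membership.Propositional using (_∈_; _∉_; find)
open import Data.List.Membership.Propositional.Properties using (∈-∃++; ∈-++⁺ˡ; ∈-++⁺ʳ; ∈-++⁻; ∈-map⁺; ∈-map⁻; ∈-upTo⁺; ∈-filter⁺; ∈-filter⁻; ∈-allFin)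
open import Data.List.Properties using (map-∘; length-map; length-++; map-injective; ≡-dec; ∷-injective)
open import Data.List.Relation.Binary.Permutation.Propositional using (_↭_; refl; prep; swap)
import Data.List.Relation.Binary.Permutation.Propositional as Perm
open import Data.List.Relation.Binary.Permutation.Propositional.Properties using (shift; ↭-length; ∈-resp-↭)
open import Data.List.Relation.Binary.Sublist.Propositional using (_⊆_; []; _∷_; _∷ʳ_; minimum; ⊆-refl)
import Data.List.Relation.Binary.Sublist.Propositional as Sublist
import Data.List.Relation.Binary.Sublist.Propositional.Properties as Sublistₚ
open import Data.List.Relation.Unary.All using (All; []; _∷_)
import Data.List.Relation.Unary.All as All
import Data.List.Relation.Unary.All.Properties as Allₚ
open import Data.List.Relation.Unary.AllPairs using (AllPairs; []; _∷_)
import Data.List.Relation.Unary.AllPairs as AllPairs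
import Data.List.Relation.Unary.AllPairs.Properties as AllPairsₚ
open import Data.List.Relation.Unary.Any using (here; there)
import Data.List.Relation.Unary.Any as Any
open import Data.List.Relation.Unary.Unique.Propositional using (Unique)
import Data.List.Relation.Unary.Unique.Propositional.Properties as Uniqueₚ
open import Data.Nat using (ℕ; zero; suc; _≤_; _<_; z≤n; s≤s; _+_; _⊔_)
import Data.Nat as ℕ
open import Data.Nat.Divisibility using (_∣_; _∣0; ∣m∣n⇒∣m+n; ∣-refl; ∣⇒≤)
open import Data.Nat.Induction using (<-rec)
open import Data.Nat.ListAction using (sum)
import Data.Nat.Properties as ℕₚ
open import Data.Product using (∃; _×_; _,_; proj₁; proj₂)
open import Data.Rational using (ℚ; 0ℚ; 1ℚ; toℚᵘ)
import Data.Rational as ℚ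
import Data.Rational.Properties as ℚₚ
open import Data.Rational.Unnormalised using (mkℚᵘ; _≃_; *≡*)
import Data.Rational.Unnormalised.Properties as ℚᵘₚ
open import Data.Sum using (_⊎_; inj₁; inj₂)
open import Data.Vec using (Vec; []; _∷_; lookup; zipWith; replicate)
import Data.Vec as Vec
open import Data.Vec.Properties using (lookup∘tabulate; []=⇒lookup; lookup⇒[]=)
open import Function using (_∘_; id)
open import Function.Bundles using (mk⇔)
open import Relation.Binary.Definitions using (DecidableEquality; tri<; tri≈; tri>)
open import Relation.Binary.PropositionalEquality hiding ([_])
open import Relation.Binary.PropositionalEquality.WithK using (≡-irrelevant)
open import Relation.Nullary using (¬_; Dec; yes; no; does; contradiction)
open import Relation.Nullary.Decidable using (map′; _×-dec_; _→-dec_; _⊎-dec_; ¬?; T?; dec-true; dec-false; does-⇔; from-yes)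

-- The working principle behind minimality: in the exact triangle of a vertex the three dimensions
-- have even sum, so for a proper subset of `W`, where all three are at most 1, either all vanish or
-- exactly two are nonzero. A nonzero group of dimension 1 also lives in a single grade. So
-- acyclicity and grades can be carried from one vertex set to another without computing homology.
-- Characteristic two removes all signs, and it produces the number three: a plane over 𝔽₂ has three
-- nonzero vectors, one on each line. Colours are compared by a Mayer-Vietoris argument. If a cycle
-- avoiding `u` and a cycle avoiding `v` are homologous through a chain none of whose faces contains
-- both vertices, then their class is carried by `W − u − v`, which is impossible if that set is
-- acyclic. Along an edge there are no such faces. For two nonadjacent neighbours of a vertex the
-- faces have to be removed first, and this is possible because the common link of the two is
-- acyclic as well.

-- The exterior algebra of 𝔽₂ⁿ, which is the chain complex of the full simplex:
-- a pair (a , b) stands for a + 0 ∧ b, where a and b avoid the vertex 0.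
Chain : ℕ → Set
Chain zero    = Bool
Chain (suc n) = Chain n × Chain n

infixl 6 _⊕_
_⊕_ : ∀ {n} → Chain n → Chain n → Chain n
_⊕_ {zero}  x y = x xor y
_⊕_ {suc n} (a , b) (c , d) = a ⊕ c , b ⊕ d

𝟘 : ∀ {n} → Chain n
𝟘 {zero}  = false
𝟘 {suc n} = 𝟘 , 𝟘

⊕-comm : ∀ {n} (x y : Chain n) → x ⊕ y ≡ y ⊕ x
⊕-comm {zero}  x y = 𝔹.xor-comm x y
⊕-comm {suc n} (a , b) (c , d) = cong₂ _,_ (⊕-comm a c) (⊕-comm b d)

⊕-assoc : ∀ {n} (x y z : Chain n) → (x ⊕ y) ⊕ z ≡ x ⊕ (y ⊕ z)
⊕-assoc {zero}  x y z = 𝔹.xor-assoc x y z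
⊕-assoc {suc n} (a , b) (c , d) (e , f) = cong₂ _,_ (⊕-assoc a c e) (⊕-assoc b d f)

⊕-identityˡ : ∀ {n} (x : Chain n) → 𝟘 ⊕ x ≡ x
⊕-identityˡ {zero}  x = refl
⊕-identityˡ {suc n} (a , b) = cong₂ _,_ (⊕-identityˡ a) (⊕-identityˡ b)

⊕-identityʳ : ∀ {n} (x : Chain n) → x ⊕ 𝟘 ≡ x
⊕-identityʳ x = trans (⊕-comm x 𝟘) (⊕-identityˡ x)

⊕-self : ∀ {n} (x : Chain n) → x ⊕ x ≡ 𝟘
⊕-self {zero}  x = 𝔹.xor-same x
⊕-self {suc n} (a , b) = cong₂ _,_ (⊕-self a) (⊕-self b)

⊕-interchange : ∀ {n} (a b c d : Chain n) → (a ⊕ b) ⊕ (c ⊕ d) ≡ (a ⊕ c) ⊕ (b ⊕ d)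
⊕-interchange a b c d = begin
  (a ⊕ b) ⊕ (c ⊕ d) ≡⟨ ⊕-assoc a b (c ⊕ d) ⟩
  a ⊕ (b ⊕ (c ⊕ d)) ≡⟨ cong (a ⊕_) (⊕-assoc b c d) ⟨
  a ⊕ ((b ⊕ c) ⊕ d) ≡⟨ cong (λ u → a ⊕ (u ⊕ d)) (⊕-comm b c) ⟩
  a ⊕ ((c ⊕ b) ⊕ d) ≡⟨ cong (a ⊕_) (⊕-assoc c b d) ⟩
  a ⊕ (c ⊕ (b ⊕ d)) ≡⟨ ⊕-assoc a c (b ⊕ d) ⟨
  (a ⊕ c) ⊕ (b ⊕ d) ∎
  where open ≡-Reasoning

-- Reflection for sums in characteristic two

data Expr (m : ℕ) : Set where
  var  : Fin m → Expr m
  nil  : Expr m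
  _⊞_  : Expr m → Expr m → Expr m

infixl 6 _⊞_

⟦_⟧ : ∀ {m n} → Expr m → Vec (Chain n) m → Chain n
⟦ var i ⟧ ρ = lookup ρ i
⟦ nil   ⟧ ρ = 𝟘
⟦ e ⊞ f ⟧ ρ = ⟦ e ⟧ ρ ⊕ ⟦ f ⟧ ρ

unit : ∀ {m} → Fin m → Vec Bool m
unit zero    = true ∷ replicate _ false
unit (suc i) = false ∷ unit i

normal : ∀ {m} → Expr m → Vec Bool m
normal (var i) = unit i
normal nil     = replicate _ false
normal (e ⊞ f) = zipWith _xor_ (normal e) (normal f)

infixr 7 _·_
_·_ : ∀ {n} → Bool → Chain n → Chain n
true  · x = x
false · x = 𝟘

·-xor : ∀ {n} b c (x : Chain n) → (b xor c) · x ≡ b · x ⊕ c · x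
·-xor true  true  x = sym (⊕-self x)
·-xor true  false x = sym (⊕-identityʳ x)
·-xor false c     x = sym (⊕-identityˡ (c · x))

combine : ∀ {m n} → Vec Bool m → Vec (Chain n) m → Chain n
combine []       []      = 𝟘
combine (b ∷ bs) (x ∷ ρ) = b · x ⊕ combine bs ρ

combine-zero : ∀ {m n} (ρ : Vec (Chain n) m) → combine (replicate m false) ρ ≡ 𝟘
combine-zero []      = refl
combine-zero (x ∷ ρ) = trans (⊕-identityˡ _) (combine-zero ρ)

combine-unit : ∀ {m n} (i : Fin m) (ρ : Vec (Chain n) m) → combine (unit i) ρ ≡ lookup ρ i
combine-unit zero    (x ∷ ρ) = trans (cong (x ⊕_) (combine-zero ρ)) (⊕-identityʳ x)
combine-unit (suc i) (x ∷ ρ) = trans (⊕-identityˡ _) (combine-unit i ρ)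

combine-xor : ∀ {m n} (bs cs : Vec Bool m) (ρ : Vec (Chain n) m) →
  combine (zipWith _xor_ bs cs) ρ ≡ combine bs ρ ⊕ combine cs ρ
combine-xor []       []       []      = sym (⊕-identityˡ 𝟘)
combine-xor (b ∷ bs) (c ∷ cs) (x ∷ ρ) =
  trans (cong₂ _⊕_ (·-xor b c x) (combine-xor bs cs ρ)) (⊕-interchange (b · x) _ _ _)

normal-correct : ∀ {m n} (e : Expr m) (ρ : Vec (Chain n) m) → ⟦ e ⟧ ρ ≡ combine (normal e) ρ
normal-correct (var i) ρ = sym (combine-unit i ρ)
normal-correct nil     ρ = sym (combine-zero ρ)
normal-correct (e ⊞ f) ρ =
  trans (cong₂ _⊕_ (normal-correct e ρ) (normal-correct f ρ))
        (sym (combine-xor (normal e) (normal f) ρ))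

-- Only the parity of the number of occurrences of each variable matters, so two Boolean vectors
-- decide the identity and `refl` is the proof to supply.
⊕-solve : ∀ {m n} (ρ : Vec (Chain n) m) (e f : Expr m) → normal e ≡ normal f → ⟦ e ⟧ ρ ≡ ⟦ f ⟧ ρ
⊕-solve ρ e f eq =
  trans (normal-correct e ρ) (trans (cong (λ bs → combine bs ρ) eq) (sym (normal-correct f ρ)))

pattern v₀ = var zero
pattern v₁ = var (suc zero)
pattern v₂ = var (suc (suc zero))
pattern v₃ = var (suc (suc (suc zero)))

cancelˡ : ∀ {n} (x y : Chain n) → x ⊕ (x ⊕ y) ≡ y
cancelˡ x y = ⊕-solve (x ∷ y ∷ []) (v₀ ⊞ (v₀ ⊞ v₁)) v₁ refl

-- Boundary, contraction and exterior multiplication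

-- ι v and ε v are contraction by v and exterior multiplication by v; ∂ is the sum of all ι v.
∂ : ∀ {n} → Chain n → Chain n
∂ {zero}  _ = false
∂ {suc n} (a , b) = ∂ a ⊕ b , ∂ b

ι : ∀ {n} → Fin n → Chain n → Chain n
ι zero    (a , b) = b , 𝟘
ι (suc v) (a , b) = ι v a , ι v b

ε : ∀ {n} → Fin n → Chain n → Chain n
ε zero    (a , b) = 𝟘 , a
ε (suc v) (a , b) = ε v a , ε v b

∂-⊕ : ∀ {n} (x y : Chain n) → ∂ (x ⊕ y) ≡ ∂ x ⊕ ∂ y
∂-⊕ {zero}  x y = refl
∂-⊕ {suc n} (a , b) (c , d) =
  cong₂ _,_ (trans (cong (_⊕ (b ⊕ d)) (∂-⊕ a c)) (⊕-interchange (∂ a) (∂ c) b d)) (∂-⊕ b d)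

∂-𝟘 : ∀ {n} → ∂ {n} 𝟘 ≡ 𝟘
∂-𝟘 {zero}  = refl
∂-𝟘 {suc n} = cong₂ _,_ (trans (⊕-identityʳ _) (∂-𝟘 {n})) (∂-𝟘 {n})

ι-⊕ : ∀ {n} v (x y : Chain n) → ι v (x ⊕ y) ≡ ι v x ⊕ ι v y
ι-⊕ zero    (a , b) (c , d) = cong (b ⊕ d ,_) (sym (⊕-identityˡ 𝟘))
ι-⊕ (suc v) (a , b) (c , d) = cong₂ _,_ (ι-⊕ v a c) (ι-⊕ v b d)

ι-𝟘 : ∀ {n} (v : Fin n) → ι v 𝟘 ≡ 𝟘
ι-𝟘 zero    = refl
ι-𝟘 (suc v) = cong₂ _,_ (ι-𝟘 v) (ι-𝟘 v)

ε-⊕ : ∀ {n} v (x y : Chain n) → ε v (x ⊕ y) ≡ ε v x ⊕ ε v y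
ε-⊕ zero    (a , b) (c , d) = cong (_, a ⊕ c) (sym (⊕-identityˡ 𝟘))
ε-⊕ (suc v) (a , b) (c , d) = cong₂ _,_ (ε-⊕ v a c) (ε-⊕ v b d)

ε-𝟘 : ∀ {n} (v : Fin n) → ε v 𝟘 ≡ 𝟘
ε-𝟘 zero    = refl
ε-𝟘 (suc v) = cong₂ _,_ (ε-𝟘 v) (ε-𝟘 v)

∂∂ : ∀ {n} (x : Chain n) → ∂ (∂ x) ≡ 𝟘
∂∂ {zero}  x = refl
∂∂ {suc n} (a , b) = cong₂ _,_ eq (∂∂ b)
  where
  open ≡-Reasoning
  eq : ∂ (∂ a ⊕ b) ⊕ ∂ b ≡ 𝟘
  eq = begin
    ∂ (∂ a ⊕ b) ⊕ ∂ b     ≡⟨ cong (_⊕ ∂ b) (∂-⊕ (∂ a) b) ⟩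
    (∂ (∂ a) ⊕ ∂ b) ⊕ ∂ b ≡⟨ cong (λ u → (u ⊕ ∂ b) ⊕ ∂ b) (∂∂ a) ⟩
    (𝟘 ⊕ ∂ b) ⊕ ∂ b       ≡⟨ ⊕-solve (∂ b ∷ []) ((nil ⊞ v₀) ⊞ v₀) nil refl ⟩
    𝟘                     ∎

-- The Leibniz rule with ∂v = 1. It makes multiplication by `v` a contracting homotopy, which is why
-- cones with apex `v` are acyclic.
∂-ε : ∀ {n} v (x : Chain n) → ∂ (ε v x) ≡ x ⊕ ε v (∂ x)
∂-ε zero    (a , b) = cong₂ _,_
  (trans (cong (_⊕ a) ∂-𝟘) (⊕-comm 𝟘 a))
  (⊕-solve (∂ a ∷ b ∷ []) v₀ (v₁ ⊞ (v₀ ⊞ v₁)) refl)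
∂-ε (suc v) (a , b) = cong₂ _,_ eq (∂-ε v b)
  where
  open ≡-Reasoning
  eq : ∂ (ε v a) ⊕ ε v b ≡ a ⊕ ε v (∂ a ⊕ b)
  eq = begin
    ∂ (ε v a) ⊕ ε v b         ≡⟨ cong (_⊕ ε v b) (∂-ε v a) ⟩
    (a ⊕ ε v (∂ a)) ⊕ ε v b   ≡⟨ ⊕-assoc a _ _ ⟩
    a ⊕ (ε v (∂ a) ⊕ ε v b)   ≡⟨ cong (a ⊕_) (ε-⊕ v (∂ a) b) ⟨
    a ⊕ ε v (∂ a ⊕ b)         ∎

ι-∂ : ∀ {n} v (x : Chain n) → ι v (∂ x) ≡ ∂ (ι v x)
ι-∂ zero    (a , b) = cong₂ _,_ (sym (⊕-identityʳ (∂ b))) (sym ∂-𝟘)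
ι-∂ (suc v) (a , b) =
  cong₂ _,_ (trans (ι-⊕ v (∂ a) b) (cong (_⊕ ι v b) (ι-∂ v a))) (ι-∂ v b)

ι-ι : ∀ {n} v (x : Chain n) → ι v (ι v x) ≡ 𝟘
ι-ι zero    (a , b) = refl
ι-ι (suc v) (a , b) = cong₂ _,_ (ι-ι v a) (ι-ι v b)

ι-comm : ∀ {n} u v (x : Chain n) → ι u (ι v x) ≡ ι v (ι u x)
ι-comm zero    zero    x = refl
ι-comm zero    (suc v) (a , b) = cong (ι v b ,_) (sym (ι-𝟘 v))
ι-comm (suc u) zero    (a , b) = cong (ι u b ,_) (ι-𝟘 u)
ι-comm (suc u) (suc v) (a , b) = cong₂ _,_ (ι-comm u v a) (ι-comm u v b)

-- The anticommutation relation of the exterior algebra; for distinct vertices its right-hand side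
-- loses the term `x`, which gives `ι-ε-comm`.
ι-ε : ∀ {n} v (x : Chain n) → ι v (ε v x) ≡ x ⊕ ε v (ι v x)
ι-ε zero    (a , b) = cong₂ _,_ (sym (⊕-identityʳ a)) (sym (⊕-self b))
ι-ε (suc v) (a , b) = cong₂ _,_ (ι-ε v a) (ι-ε v b)

ι-ε-comm : ∀ {n} {u v} → u ≢ v → (x : Chain n) → ι u (ε v x) ≡ ε v (ι u x)
ι-ε-comm {u = zero}  {zero}  ne x = contradiction refl ne
ι-ε-comm {u = zero}  {suc v} ne (a , b) = cong (ε v b ,_) (sym (ε-𝟘 v))
ι-ε-comm {u = suc u} {zero}  ne (a , b) = cong (_, ι u a) (ι-𝟘 u)
ι-ε-comm {u = suc u} {suc v} ne (a , b) =
  cong₂ _,_ (ι-ε-comm (ne ∘ cong suc) a) (ι-ε-comm (ne ∘ cong suc) b)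

-- Grading by the number of vertices

π : ∀ {n} → ℕ → Chain n → Chain n
π {zero}  zero    x = x
π {zero}  (suc s) x = false
π {suc n} zero    (a , b) = π zero a , 𝟘
π {suc n} (suc s) (a , b) = π (suc s) a , π s b

π-⊕ : ∀ {n} s (x y : Chain n) → π s (x ⊕ y) ≡ π s x ⊕ π s y
π-⊕ {zero}  zero    x y = refl
π-⊕ {zero}  (suc s) x y = refl
π-⊕ {suc n} zero    (a , b) (c , d) = cong₂ _,_ (π-⊕ zero a c) (sym (⊕-identityˡ 𝟘))
π-⊕ {suc n} (suc s) (a , b) (c , d) = cong₂ _,_ (π-⊕ (suc s) a c) (π-⊕ s b d)

π-𝟘 : ∀ {n} s → π {n} s 𝟘 ≡ 𝟘
π-𝟘 {zero}  zero    = refl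
π-𝟘 {zero}  (suc s) = refl
π-𝟘 {suc n} zero    = cong (_, 𝟘) (π-𝟘 {n} zero)
π-𝟘 {suc n} (suc s) = cong₂ _,_ (π-𝟘 {n} (suc s)) (π-𝟘 {n} s)

π-idem : ∀ {n} s (x : Chain n) → π s (π s x) ≡ π s x
π-idem {zero}  zero    x = refl
π-idem {zero}  (suc s) x = refl
π-idem {suc n} zero    (a , b) = cong (_, 𝟘) (π-idem zero a)
π-idem {suc n} (suc s) (a , b) = cong₂ _,_ (π-idem (suc s) a) (π-idem s b)

π-orth : ∀ {n} {s t} → s ≢ t → (x : Chain n) → π s (π t x) ≡ 𝟘
π-orth {zero}  {zero}  {zero}  ne x = contradiction refl ne
π-orth {zero}  {zero}  {suc t} ne x = refl
π-orth {zero}  {suc s} {t}     ne x = refl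
π-orth {suc n} {zero}  {zero}  ne x = contradiction refl ne
π-orth {suc n} {zero}  {suc t} ne (a , b) = cong (_, 𝟘) (π-orth ne a)
π-orth {suc n} {suc s} {zero}  ne (a , b) = cong₂ _,_ (π-orth ne a) (π-𝟘 s)
π-orth {suc n} {suc s} {suc t} ne (a , b) = cong₂ _,_ (π-orth ne a) (π-orth (ne ∘ cong suc) b)

∂-π-zero : ∀ {n} (x : Chain n) → ∂ (π 0 x) ≡ 𝟘
∂-π-zero {zero}  x = refl
∂-π-zero {suc n} (a , b) = cong₂ _,_ (trans (⊕-identityʳ _) (∂-π-zero a)) (∂-𝟘 {n})

-- Grades count vertices, not dimensions: the empty face has grade 0, and the augmentation is the
-- part of `∂` from grade 1 to grade 0. So the homology below is reduced homology.
∂-π : ∀ {n} s (x : Chain n) → ∂ (π (suc s) x) ≡ π s (∂ x)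
∂-π {zero}  zero    x = refl
∂-π {zero}  (suc s) x = refl
∂-π {suc n} zero    (a , b) =
  cong₂ _,_ (trans (cong (_⊕ π 0 b) (∂-π 0 a)) (sym (π-⊕ 0 (∂ a) b))) (∂-π-zero b)
∂-π {suc n} (suc s) (a , b) =
  cong₂ _,_ (trans (cong (_⊕ π (suc s) b) (∂-π (suc s) a)) (sym (π-⊕ (suc s) (∂ a) b))) (∂-π s b)

ι-π-zero : ∀ {n} v (x : Chain n) → ι v (π 0 x) ≡ 𝟘
ι-π-zero zero    (a , b) = refl
ι-π-zero (suc v) (a , b) = cong₂ _,_ (ι-π-zero v a) (ι-𝟘 v)

ι-π : ∀ {n} v s (x : Chain n) → ι v (π (suc s) x) ≡ π s (ι v x)
ι-π zero    zero    (a , b) = refl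
ι-π zero    (suc s) (a , b) = cong (π (suc s) b ,_) (sym (π-𝟘 s))
ι-π (suc v) zero    (a , b) = cong₂ _,_ (ι-π v 0 a) (ι-π-zero v b)
ι-π (suc v) (suc s) (a , b) = cong₂ _,_ (ι-π v (suc s) a) (ι-π v s b)

π-ε : ∀ {n} v s (x : Chain n) → π (suc s) (ε v x) ≡ ε v (π s x)
π-ε zero    zero    (a , b) = cong (_, π 0 a) (π-𝟘 1)
π-ε zero    (suc s) (a , b) = cong (_, π (suc s) a) (π-𝟘 (suc (suc s)))
π-ε (suc v) zero    (a , b) = cong₂ _,_ (π-ε v 0 a) (trans (π-ε-zero v b) (sym (ε-𝟘 v)))
  where
  π-ε-zero : ∀ {n} v (x : Chain n) → π 0 (ε v x) ≡ 𝟘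
  π-ε-zero zero    (a , b) = cong (_, 𝟘) (π-𝟘 0)
  π-ε-zero (suc v) (a , b) = cong (_, 𝟘) (π-ε-zero v a)
π-ε (suc v) (suc s) (a , b) = cong₂ _,_ (π-ε v (suc s) a) (π-ε v s b)

π-large : ∀ {n} s → n < s → (x : Chain n) → π s x ≡ 𝟘
π-large {zero}  (suc s) n<s x = refl
π-large {suc n} (suc s) (s≤s n<s) (a , b) =
  cong₂ _,_ (π-large (suc s) (ℕₚ.m<n⇒m<1+n n<s) a) (π-large s n<s b)

π-sum : ∀ {n} → ℕ → Chain n → Chain n
π-sum zero    x = 𝟘
π-sum (suc m) x = π-sum m x ⊕ π m x

π-sum-all : ∀ {n} (x : Chain n) → π-sum (suc n) x ≡ x
π-sum-all {zero}  x = refl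
π-sum-all {suc n} (a , b) = trans (split (suc n) a b) (cong₂ _,_ eq (π-sum-all b))
  where
  -- The second component lags by one grade because its faces also contain the vertex 0.
  split : ∀ {n} m (a b : Chain n) → π-sum (suc m) (a , b) ≡ (π-sum (suc m) a , π-sum m b)
  split zero    a b = cong₂ _,_ refl (⊕-identityˡ 𝟘)
  split (suc m) a b = cong (_⊕ (π (suc m) a , π m b)) (split m a b)
  eq : π-sum (suc (suc n)) a ≡ a
  eq = trans (cong₂ _⊕_ (π-sum-all a) (π-large (suc n) ℕₚ.≤-refl a)) (⊕-identityʳ a)

_≟ᶜ_ : ∀ {n} (x y : Chain n) → Dec (x ≡ y)
_≟ᶜ_ {zero}  x y = x 𝔹.≟ y
_≟ᶜ_ {suc n} (a , b) (c , d) =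
  map′ (λ { (refl , refl) → refl }) (λ { refl → refl , refl }) ((a ≟ᶜ c) ×-dec (b ≟ᶜ d))

abstract
  -- There are only finitely many chains, so exhaustive search takes the place of excluded middle in
  -- all later case distinctions. It is sealed so that the search is not unfolded.
  any-chain? : ∀ {n} {P : Chain n → Set} → (∀ x → Dec (P x)) → Dec (∃ P)
  any-chain? {zero} P? with P? true | P? false
  ... | yes p | _     = yes (true , p)
  ... | no ¬p | yes q = yes (false , q)
  ... | no ¬p | no ¬q = no λ { (true , p) → ¬p p ; (false , q) → ¬q q }
  any-chain? {suc n} {P} P? =
    map′ (λ { (a , b , p) → (a , b) , p }) (λ { ((a , b) , p) → a , b , p })
         (any-chain? (λ a → any-chain? (λ b → P? (a , b))))

-- Vertex sets

VSet : ℕ → Set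
VSet n = Fin n → Bool

infixl 6 _⊓_
_⊓_ : ∀ {n} → VSet n → VSet n → VSet n
(W ⊓ A) u = W u ∧ A u

infix 4 _⊑_
-- Inclusion in contrapositive form, because the support of a chain is described by the vertices
-- that it misses.
_⊑_ : ∀ {n} → VSet n → VSet n → Set
W ⊑ X = ∀ u → X u ≡ false → W u ≡ false

-- W ⊓ dl v is W − v, and W ⊓ lk v below is W − N[v].
dl : ∀ {n} → Fin n → VSet n
dl v u = not (does (u Fin.≟ v))

dl-self : ∀ {n} (v : Fin n) → dl v v ≡ false
dl-self v = cong not (dec-true (v Fin.≟ v) refl)

dl-≢ : ∀ {n} {u v : Fin n} → u ≢ v → dl v u ≡ true
dl-≢ ne = cong not (dec-false (_ Fin.≟ _) ne)

dl-false : ∀ {n} (u v : Fin n) → dl v u ≡ false → u ≡ v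
dl-false u v eq with u Fin.≟ v
... | yes p = p
... | no  _ = contradiction eq λ ()

⊓-falseˡ : ∀ {n} {W A : VSet n} {u} → W u ≡ false → (W ⊓ A) u ≡ false
⊓-falseˡ eq rewrite eq = refl

⊓-falseʳ : ∀ {n} {W A : VSet n} {u} → A u ≡ false → (W ⊓ A) u ≡ false
⊓-falseʳ {W = W} {u = u} eq rewrite eq = 𝔹.∧-zeroʳ (W u)

⊓-false : ∀ {n} {W A : VSet n} {u} → (W ⊓ A) u ≡ false → W u ≡ false ⊎ A u ≡ false
⊓-false {W = W} {u = u} eq with W u
... | false = inj₁ refl
... | true  = inj₂ eq

⊓-true : ∀ {n} {W A : VSet n} {u} → (W ⊓ A) u ≡ true → W u ≡ true × A u ≡ true
⊓-true {W = W} {A} {u} eq with W u | A u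
... | true | true = refl , refl

⊓-true⁺ : ∀ {n} {W A : VSet n} {u} → W u ≡ true → A u ≡ true → (W ⊓ A) u ≡ true
⊓-true⁺ p q rewrite p | q = refl

≗⇒⊑ : ∀ {n} {W X : VSet n} → W ≗ X → W ⊑ X
≗⇒⊑ eq u p = trans (eq u) p

⊑-trans : ∀ {n} {W X Y : VSet n} → W ⊑ X → X ⊑ Y → W ⊑ Y
⊑-trans p q u eq = p u (q u eq)

⊓-⊑ˡ : ∀ {n} {W A : VSet n} → W ⊓ A ⊑ W
⊓-⊑ˡ {W = W} {A} u = ⊓-falseˡ {W = W} {A}

⊓-monoʳ : ∀ {n} {W A B : VSet n} → A ⊑ B → W ⊓ A ⊑ W ⊓ B
⊓-monoʳ {W = W} {A} {B} p u eq with ⊓-false {W = W} {B} eq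
... | inj₁ q = ⊓-falseˡ {W = W} {A} q
... | inj₂ q = ⊓-falseʳ {W = W} {A} (p u q)

⊓-swap : ∀ {n} (W A B : VSet n) → W ⊓ A ⊓ B ≗ W ⊓ B ⊓ A
⊓-swap W A B u with W u | A u | B u
... | false | _     | _     = refl
... | true  | false | false = refl
... | true  | false | true  = refl
... | true  | true  | false = refl
... | true  | true  | true  = refl

infixl 6 _⊝_
_⊝_ : ∀ {n} → VSet n → List (Fin n) → VSet n
W ⊝ []      = W
W ⊝ (y ∷ Y) = W ⊝ Y ⊓ dl y

⊝-⊑ : ∀ {n} {W : VSet n} Y → W ⊝ Y ⊑ W
⊝-⊑ []          u eq = eq
⊝-⊑ {W = W} (y ∷ Y) u eq = ⊓-falseˡ {W = W ⊝ Y} {dl y} (⊝-⊑ Y u eq)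

⊓-⊝ : ∀ {n} (W A : VSet n) Y → W ⊓ A ⊝ Y ≗ W ⊝ Y ⊓ A
⊓-⊝ W A []      u = refl
⊓-⊝ W A (y ∷ Y) u =
  trans (cong (_∧ dl y u) (⊓-⊝ W A Y u)) (⊓-swap (W ⊝ Y) A (dl y) u)

⊝-∈ : ∀ {n} {W : VSet n} {Y u} → u ∈ Y → (W ⊝ Y) u ≡ false
⊝-∈ {W = W} {y ∷ Y} (here refl) = ⊓-falseʳ {W = W ⊝ Y} {dl y} (dl-self y)
⊝-∈ {W = W} {y ∷ Y} (there u∈Y) = ⊓-falseˡ {W = W ⊝ Y} {dl y} (⊝-∈ u∈Y)

⊝-false : ∀ {n} {W : VSet n} Y {u} → (W ⊝ Y) u ≡ false → W u ≡ false ⊎ u ∈ Y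
⊝-false []      eq = inj₁ eq
⊝-false {W = W} (y ∷ Y) eq with ⊓-false {W = W ⊝ Y} {dl y} eq
... | inj₂ q = inj₂ (here (dl-false _ y q))
... | inj₁ p with ⊝-false Y p
...   | inj₁ r = inj₁ r
...   | inj₂ r = inj₂ (there r)

⊝-∈-≢ : ∀ {n} {W : VSet n} {Y u a} → (W ⊝ Y) u ≡ true → a ∈ Y → (W ⊓ dl a) u ≡ true
⊝-∈-≢ {W = W} {Y} {u} {a} eq a∈Y = ⊓-true⁺ {W = W} {dl a} Wu (dl-≢ ne)
  where
  Wu : W u ≡ true
  Wu with W u in e
  ... | true  = refl
  ... | false = contradiction (trans (sym eq) (⊝-⊑ Y u e)) λ ()
  ne : u ≢ a
  ne refl = contradiction (trans (sym eq) (⊝-∈ a∈Y)) λ ()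

-- Homology of independence complexes over 𝔽₂

module Complex {n : ℕ} (G : Graph n) where

  lk : Fin n → VSet n
  lk v u = dl v u ∧ not (adj G v u)

  lk-self : ∀ v → lk v v ≡ false
  lk-self v rewrite dl-self v = refl

  lk-adj : ∀ {u v} → adj G v u ≡ true → lk v u ≡ false
  lk-adj {u} {v} eq rewrite eq = 𝔹.∧-zeroʳ (dl v u)

  lk⊑dl : ∀ {v} → lk v ⊑ dl v
  lk⊑dl u eq rewrite eq = refl

  adj-≢ : ∀ {u v} → adj G u v ≡ true → u ≢ v
  adj-≢ {u} p refl = contradiction (trans (sym p) (irrefl G u)) λ ()

  -- x is a chain of the independence complex of the subgraph induced on W.
  Supp : VSet n → Chain n → Set
  Supp W x = (∀ u → W u ≡ false → ι u x ≡ 𝟘) ×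
             (∀ u w → adj G u w ≡ true → ι u (ι w x) ≡ 𝟘)

  Bd : VSet n → Chain n → Set
  Bd W z = ∃ λ c → Supp W c × ∂ c ≡ z

  record Cycle (W : VSet n) (z : Chain n) : Set where
    constructor cyc
    field
      supp   : Supp W z
      closed : ∂ z ≡ 𝟘
  open Cycle

  Acyclic : VSet n → Set
  Acyclic W = ∀ z → Cycle W z → Bd W z

  NonAcyclic : VSet n → Set
  NonAcyclic W = ∃ λ z → Cycle W z × ¬ Bd W z

  NonAcyclicᵍ : ℕ → VSet n → Set
  NonAcyclicᵍ t W = ∃ λ z → Cycle W z × ¬ Bd W z × π t z ≡ z

  -- Over 𝔽₂ two vectors are dependent exactly when one of them or their sum is zero. So this says
  -- that the total homology, all grades together, has dimension at most 1.
  Rank≤1 : VSet n → Set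
  Rank≤1 W = ∀ z w → Cycle W z → Cycle W w → Bd W z ⊎ Bd W w ⊎ Bd W (z ⊕ w)

  Supp-⊕ : ∀ {W x y} → Supp W x → Supp W y → Supp W (x ⊕ y)
  Supp-⊕ {W} {x} {y} (p , q) (r , s) =
    (λ u eq → trans (ι-⊕ u x y) (trans (cong₂ _⊕_ (p u eq) (r u eq)) (⊕-self 𝟘))) ,
    (λ u w eq → begin
      ι u (ι w (x ⊕ y))         ≡⟨ cong (ι u) (ι-⊕ w x y) ⟩
      ι u (ι w x ⊕ ι w y)       ≡⟨ ι-⊕ u _ _ ⟩
      ι u (ι w x) ⊕ ι u (ι w y) ≡⟨ cong₂ _⊕_ (q u w eq) (s u w eq) ⟩
      𝟘 ⊕ 𝟘                     ≡⟨ ⊕-self 𝟘 ⟩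
      𝟘                         ∎)
    where open ≡-Reasoning

  Supp-𝟘 : ∀ {W} → Supp W 𝟘
  Supp-𝟘 = (λ u _ → ι-𝟘 u) , (λ u w _ → trans (cong (ι u) (ι-𝟘 w)) (ι-𝟘 u))

  Supp-∂ : ∀ {W x} → Supp W x → Supp W (∂ x)
  Supp-∂ {W} {x} (p , q) =
    (λ u eq → trans (ι-∂ u x) (trans (cong ∂ (p u eq)) ∂-𝟘)) ,
    (λ u w eq → trans (cong (ι u) (ι-∂ w x)) (trans (ι-∂ u _) (trans (cong ∂ (q u w eq)) ∂-𝟘)))

  Supp-π : ∀ {W x} s → Supp W x → Supp W (π s x)
  Supp-π {W} {x} zero (p , q) =
    (λ u _ → ι-π-zero u x) , (λ u w _ → trans (cong (ι u) (ι-π-zero w x)) (ι-𝟘 u))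
  Supp-π {W} {x} (suc s) (p , q) =
    (λ u eq → trans (ι-π u s x) (trans (cong (π s) (p u eq)) (π-𝟘 s))) , edge s
    where
    edge : ∀ s u w → adj G u w ≡ true → ι u (ι w (π (suc s) x)) ≡ 𝟘
    edge zero    u w eq = trans (cong (ι u) (ι-π w 0 x)) (ι-π-zero u (ι w x))
    edge (suc s) u w eq =
      trans (cong (ι u) (ι-π w (suc s) x))
            (trans (ι-π u s (ι w x)) (trans (cong (π s) (q u w eq)) (π-𝟘 s)))

  Supp-mono : ∀ {W X x} → W ⊑ X → Supp W x → Supp X x
  Supp-mono W⊑X (p , q) = (λ u eq → p u (W⊑X u eq)) , q

  Supp-dl : ∀ {W x} v → Supp W x → ι v x ≡ 𝟘 → Supp (W ⊓ dl v) x
  Supp-dl {W} {x} v (p , q) ιx = r , q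
    where
    r : ∀ u → (W ⊓ dl v) u ≡ false → ι u x ≡ 𝟘
    r u eq with ⊓-false {W = W} {dl v} eq
    ... | inj₁ e = p u e
    ... | inj₂ e with refl ← dl-false u v e = ιx

  Supp-ι : ∀ {W x} v → Supp W x → Supp (W ⊓ lk v) (ι v x)
  Supp-ι {W} {x} v (p , q) = r , λ u w eq → trans (cong (ι u) (ι-comm w v x))
      (trans (ι-comm u v _) (trans (cong (ι v) (q u w eq)) (ι-𝟘 v)))
    where
    r : ∀ u → (W ⊓ lk v) u ≡ false → ι u (ι v x) ≡ 𝟘
    r u eq with ⊓-false {W = W} {lk v} eq
    ... | inj₁ e = trans (ι-comm u v x) (trans (cong (ι v) (p u e)) (ι-𝟘 v))
    ... | inj₂ e with ⊓-false {W = dl v} {λ w → not (adj G v w)} {u} e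
    ...   | inj₁ f with refl ← dl-false u v f = ι-ι v x
    ...   | inj₂ f = trans (ι-comm u v x) (q v u (𝔹.not-injective f))

  Supp-ε : ∀ {W c} v → W v ≡ true → Supp (W ⊓ lk v) c → Supp W (ε v c)
  Supp-ε {W} {c} v Wv (p , q) = r , s
    where
    r : ∀ u → W u ≡ false → ι u (ε v c) ≡ 𝟘
    r u eq = trans (ι-ε-comm (λ { refl → contradiction (trans (sym Wv) eq) λ () }) c)
      (trans (cong (ε v) (p u (⊓-falseˡ {W = W} {lk v} eq))) (ε-𝟘 v))
    nbr : ∀ w → adj G v w ≡ true → ι v (ι w (ε v c)) ≡ 𝟘
    nbr w eq = begin
      ι v (ι w (ε v c)) ≡⟨ cong (ι v) (ι-ε-comm (adj-≢ eq ∘ sym) c) ⟩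
      ι v (ε v (ι w c)) ≡⟨ cong (ι v ∘ ε v) (p w (⊓-falseʳ {W = W} {lk v} (lk-adj eq))) ⟩
      ι v (ε v 𝟘)       ≡⟨ cong (ι v) (ε-𝟘 v) ⟩
      ι v 𝟘             ≡⟨ ι-𝟘 v ⟩
      𝟘                 ∎
      where open ≡-Reasoning
    s : ∀ u w → adj G u w ≡ true → ι u (ι w (ε v c)) ≡ 𝟘
    s u w eq with u Fin.≟ v | w Fin.≟ v
    ... | yes refl | _        = nbr w eq
    ... | no  _    | yes refl =
      trans (ι-comm u v _) (nbr u (trans (Graph.sym G v u) eq))
    ... | no u≢v   | no w≢v   = trans (cong (ι u) (ι-ε-comm w≢v c))
      (trans (ι-ε-comm u≢v _) (trans (cong (ε v) (q u w eq)) (ε-𝟘 v)))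

  ι-vanish : ∀ {W x} v → Supp (W ⊓ dl v) x → ι v x ≡ 𝟘
  ι-vanish {W} v (p , q) = p v (⊓-falseʳ {W = W} {dl v} (dl-self v))

  ι-vanish-lk : ∀ {W x} v → Supp (W ⊓ lk v) x → ι v x ≡ 𝟘
  ι-vanish-lk {W} v (p , q) = p v (⊓-falseʳ {W = W} {lk v} (lk-self v))

  ι-ε-vanish : ∀ {x : Chain n} v → ι v x ≡ 𝟘 → ι v (ε v x) ≡ x
  ι-ε-vanish {x} v eq =
    trans (ι-ε v x) (trans (cong (λ y → x ⊕ ε v y) eq) (trans (cong (x ⊕_) (ε-𝟘 v)) (⊕-identityʳ x)))

  -- The part of `x` whose faces avoid `v`: the term `ε v (ι v x)` consists of the faces through
  -- `v`.
  rest : Fin n → Chain n → Chain n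
  rest v x = x ⊕ ε v (ι v x)

  ι-rest : ∀ v x → ι v (rest v x) ≡ 𝟘
  ι-rest v x = trans (ι-⊕ v x _) (trans (cong (ι v x ⊕_) (ι-ε-vanish v (ι-ι v x))) (⊕-self _))

  Supp-rest : ∀ {W x} v → Supp W x → Supp (W ⊓ dl v) (rest v x)
  Supp-rest {W} {x} v sx with W v in Wv
  ... | true  = Supp-dl v (Supp-⊕ sx (Supp-ε v Wv (Supp-ι v sx))) (ι-rest v x)
  ... | false = subst (Supp (W ⊓ dl v)) (sym eq) (Supp-dl v sx ιx)
    where
    ιx : ι v x ≡ 𝟘
    ιx = proj₁ sx v Wv
    eq : rest v x ≡ x
    eq = trans (cong (λ y → x ⊕ ε v y) ιx) (trans (cong (x ⊕_) (ε-𝟘 v)) (⊕-identityʳ x))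

  Bd-⊕ : ∀ {W x y} → Bd W x → Bd W y → Bd W (x ⊕ y)
  Bd-⊕ (c , sc , refl) (d , sd , refl) = c ⊕ d , Supp-⊕ sc sd , ∂-⊕ c d

  Bd-cancelʳ : ∀ {W x y} → Bd W (x ⊕ y) → Bd W y → Bd W x
  Bd-cancelʳ {W} {x} {y} p q =
    subst (Bd W) (⊕-solve (x ∷ y ∷ []) ((v₀ ⊞ v₁) ⊞ v₁) v₀ refl) (Bd-⊕ p q)

  Bd-cancelˡ : ∀ {W x y} → Bd W (x ⊕ y) → Bd W x → Bd W y
  Bd-cancelˡ {W} {x} {y} p q = Bd-cancelʳ (subst (Bd W) (⊕-comm x y) p) q

  Bd-mono : ∀ {W X z} → W ⊑ X → Bd W z → Bd X z
  Bd-mono p (c , sc , eq) = c , Supp-mono p sc , eq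

  Bd-ι : ∀ {W z} v → Bd W z → Bd (W ⊓ lk v) (ι v z)
  Bd-ι v (c , sc , refl) = ι v c , Supp-ι v sc , sym (ι-∂ v c)

  Bd-π : ∀ {W z} s → Bd W z → π s z ≡ z → ∃ λ c → Supp W c × ∂ c ≡ z × π (suc s) c ≡ c
  Bd-π s (c , sc , refl) eq =
    π (suc s) c , Supp-π (suc s) sc , trans (∂-π s c) eq , π-idem (suc s) c

  Cycle-⊕ : ∀ {W x y} → Cycle W x → Cycle W y → Cycle W (x ⊕ y)
  Cycle-⊕ {x = x} {y} (cyc sx cx) (cyc sy cy) =
    cyc (Supp-⊕ sx sy) (trans (∂-⊕ x y) (trans (cong₂ _⊕_ cx cy) (⊕-self 𝟘)))

  Cycle-mono : ∀ {W X x} → W ⊑ X → Cycle W x → Cycle X x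
  Cycle-mono p (cyc sx cx) = cyc (Supp-mono p sx) cx

  Cycle-ι : ∀ {W z} v → Cycle W z → Cycle (W ⊓ lk v) (ι v z)
  Cycle-ι {z = z} v (cyc sz cz) =
    cyc (Supp-ι v sz) (trans (sym (ι-∂ v z)) (trans (cong (ι v) cz) (ι-𝟘 v)))

  Cycle-π : ∀ {W z} s → Cycle W z → Cycle W (π s z)
  Cycle-π {z = z} s (cyc sz cz) = cyc (Supp-π s sz) (closed-π s)
    where
    closed-π : ∀ s → ∂ (π s z) ≡ 𝟘
    closed-π zero    = ∂-π-zero z
    closed-π (suc s) = trans (∂-π s z) (trans (cong (π s) cz) (π-𝟘 s))

  Cycle-∂ : ∀ {W c} → Supp W c → Cycle W (∂ c)
  Cycle-∂ {c = c} sc = cyc (Supp-∂ sc) (∂∂ c)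

  Acyclic-resp : ∀ {W X} → W ≗ X → Acyclic W → Acyclic X
  Acyclic-resp eq ac z cz = Bd-mono (≗⇒⊑ eq) (ac z (Cycle-mono (≗⇒⊑ (sym ∘ eq)) cz))

  NonAcyclicᵍ-resp : ∀ {t W X} → W ≗ X → NonAcyclicᵍ t W → NonAcyclicᵍ t X
  NonAcyclicᵍ-resp eq (z , cz , nz , pz) =
    z , Cycle-mono (≗⇒⊑ eq) cz , nz ∘ Bd-mono (≗⇒⊑ (sym ∘ eq)) , pz

  forget : ∀ {t W} → NonAcyclicᵍ t W → NonAcyclic W
  forget (z , cz , nz , _) = z , cz , nz

  Acyclic⇒¬NonAcyclic : ∀ {W} → Acyclic W → ¬ NonAcyclic W
  Acyclic⇒¬NonAcyclic ac (z , cz , nz) = nz (ac z cz)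

  Supp? : ∀ W x → Dec (Supp W x)
  Supp? W x =
    Finₚ.all? (λ u → (W u 𝔹.≟ false) →-dec (ι u x ≟ᶜ 𝟘)) ×-dec
    Finₚ.all? (λ u → Finₚ.all? (λ w → (adj G u w 𝔹.≟ true) →-dec (ι u (ι w x) ≟ᶜ 𝟘)))

  abstract
    Bd? : ∀ W z → Dec (Bd W z)
    Bd? W z = any-chain? λ c → Supp? W c ×-dec (∂ c ≟ᶜ z)

  Cycle? : ∀ W z → Dec (Cycle W z)
  Cycle? W z =
    map′ (λ (s , c) → cyc s c) (λ (cyc s c) → s , c) (Supp? W z ×-dec (∂ z ≟ᶜ 𝟘))

  -- If every component of a cycle bounds, so does their sum; hence a nonzero class is already
  -- nonzero in some grade.
  homogeneous : ∀ {W z} m → Cycle W z → Bd W (π-sum m z) ⊎ ∃ λ t → ¬ Bd W (π t z)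
  homogeneous zero cz = inj₁ (𝟘 , Supp-𝟘 , ∂-𝟘)
  homogeneous {W} {z} (suc m) cz with homogeneous m cz | Bd? W (π m z)
  ... | inj₂ p | _      = inj₂ p
  ... | inj₁ p | yes q  = inj₁ (Bd-⊕ p q)
  ... | inj₁ p | no  ¬q = inj₂ (m , ¬q)

  grade : ∀ {W} → NonAcyclic W → ∃ λ t → NonAcyclicᵍ t W
  grade {W} (z , cz , nz) with homogeneous (suc n) cz
  ... | inj₁ p = contradiction (subst (Bd W) (π-sum-all z) p) nz
  ... | inj₂ (t , nt) = t , π t z , Cycle-π t cz , nt , π-idem t z

  abstract
    status : ∀ W → Acyclic W ⊎ ∃ λ t → NonAcyclicᵍ t W
    status W with any-chain? (λ z → Cycle? W z ×-dec ¬? (Bd? W z))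
    ... | yes p = inj₂ (grade p)
    ... | no ¬p = inj₁ ac
      where
      ac : Acyclic W
      ac z cz with Bd? W z
      ... | yes q = q
      ... | no ¬q = contradiction (z , cz , ¬q) ¬p

  -- Were `z ⊕ w` the boundary of `c` with `s` and `t` different, the part of `c` in grade `suc s`
  -- would have boundary `z`, since `w` has no part in grade `s`.
  Rank≤1-unique : ∀ {W s t} → Rank≤1 W → NonAcyclicᵍ s W → NonAcyclicᵍ t W → s ≡ t
  Rank≤1-unique {W} {s} {t} p1 (z , cz , nz , hz) (w , cw , nw , hw) with s ℕ.≟ t
  ... | yes eq = eq
  ... | no  ne with p1 z w cz cw
  ...   | inj₁ b = contradiction b nz
  ...   | inj₂ (inj₁ b) = contradiction b nw
  ...   | inj₂ (inj₂ (c , sc , eq)) =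
    contradiction (π (suc s) c , Supp-π (suc s) sc , bd) nz
    where
    open ≡-Reasoning
    bd : ∂ (π (suc s) c) ≡ z
    bd = begin
      ∂ (π (suc s) c)     ≡⟨ ∂-π s c ⟩
      π s (∂ c)           ≡⟨ cong (π s) eq ⟩
      π s (z ⊕ w)         ≡⟨ π-⊕ s z w ⟩
      π s z ⊕ π s w       ≡⟨ cong₂ _⊕_ hz (cong (π s) (sym hw)) ⟩
      z ⊕ π s (π t w)     ≡⟨ cong (z ⊕_) (π-orth ne w) ⟩
      z ⊕ 𝟘               ≡⟨ ⊕-identityʳ z ⟩
      z                   ∎

  -- The exact sequence of link `A`, deletion `B` and whole `W`

  module Triple (W : VSet n) (v : Fin n) where

    A B : VSet n
    A = W ⊓ lk v
    B = W ⊓ dl v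

    A⊑B : A ⊑ B
    A⊑B = ⊓-monoʳ {W = W} {lk v} {dl v} lk⊑dl

    B⊑W : B ⊑ W
    B⊑W = ⊓-⊑ˡ {W = W} {dl v}

    -- The faces of `c` through `v` and the other ones are bounded separately. As `z` avoids `v`,
    -- the contraction of `c` is a cycle of the link, homologous to `z` away from `v`: exactness at
    -- the deletion.
    split-boundary : ∀ {z c} → ι v z ≡ 𝟘 → ∂ c ≡ z →
      ∂ (ι v c) ≡ 𝟘 × z ≡ ∂ (rest v c) ⊕ ι v c
    split-boundary {z} {c} ιz refl = c₁-closed , (begin
      ∂ c                                     ≡⟨ ⊕-solve (∂ c ∷ ι v c ∷ []) v₀ ((v₀ ⊞ v₁) ⊞ v₁) refl ⟩
      (∂ c ⊕ ι v c) ⊕ ι v c                   ≡⟨ cong (λ y → (∂ c ⊕ y) ⊕ ι v c) eq ⟨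
      (∂ c ⊕ ∂ (ε v (ι v c))) ⊕ ι v c         ≡⟨ cong (_⊕ ι v c) (∂-⊕ c _) ⟨
      ∂ (rest v c) ⊕ ι v c                    ∎)
      where
      open ≡-Reasoning
      c₁-closed : ∂ (ι v c) ≡ 𝟘
      c₁-closed = trans (sym (ι-∂ v c)) ιz
      eq : ∂ (ε v (ι v c)) ≡ ι v c
      eq = trans (∂-ε v _) (trans (cong (λ y → ι v c ⊕ ε v y) c₁-closed)
             (trans (cong (ι v c ⊕_) (ε-𝟘 v)) (⊕-identityʳ _)))

    split-cycle : ∀ {z} → Cycle B z → Bd W z →
      ∃ λ y → Cycle A y × (Bd B y → Bd B z)
    split-cycle {z} cz (c , sc , eq) with split-boundary {z} {c} (ι-vanish {W} v (supp cz)) eq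
    ... | closed₁ , z≡ = ι v c , cyc (Supp-ι v sc) closed₁ ,
      λ b → subst (Bd B) (sym z≡) (Bd-⊕ (rest v c , Supp-rest v sc , refl) b)

    cone : ∀ {y} → W v ≡ true → Cycle A y → Bd W y
    cone {y} Wv (cyc sy cy) = ε v y , Supp-ε v Wv sy ,
      trans (∂-ε v y) (trans (cong (λ u → y ⊕ ε v u) cy) (trans (cong (y ⊕_) (ε-𝟘 v)) (⊕-identityʳ y)))

    -- Exactness at the link: the filling `x₀` and the cone over `y` have the same boundary, so
    -- together they form a cycle.
    lift : ∀ {y x₀} → W v ≡ true → Cycle A y → Supp B x₀ → ∂ x₀ ≡ y →
      Cycle W (x₀ ⊕ ε v y) × ι v (x₀ ⊕ ε v y) ≡ y
    lift {y} {x₀} Wv cy@(cyc sy dy) s₀ refl =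
      cyc (Supp-⊕ (Supp-mono B⊑W s₀) (Supp-ε v Wv sy))
          (trans (∂-⊕ x₀ (ε v y))
            (trans (cong (y ⊕_) (proj₂ (proj₂ (cone Wv cy)))) (⊕-self y))) ,
      trans (ι-⊕ v x₀ (ε v y))
        (trans (cong₂ _⊕_ (ι-vanish {W} v s₀) (ι-ε-vanish v (ι-vanish-lk {W} v sy))) (⊕-identityˡ y))

    -- Exactness at the whole: a filling of the contraction, coned with `v`, has a boundary that
    -- cancels all faces of `z` through `v`.
    push : ∀ {z} → Cycle W z → Bd A (ι v z) →
      ∃ λ z₀ → Cycle B z₀ × Bd W (z ⊕ z₀)
    push {z} cz (c , sc , eq) with W v in Wv
    ... | false = z , cyc (Supp-dl v (supp cz) (proj₁ (supp cz) v Wv)) (closed cz) ,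
                  𝟘 , Supp-𝟘 , trans ∂-𝟘 (sym (⊕-self z))
    ... | true = z₀ , cyc (Supp-dl v (supp cz₀) ιz₀) (closed cz₀) ,
                 ε v c , sεc , sym (cancelˡ z _)
      where
      sεc : Supp W (ε v c)
      sεc = Supp-ε v Wv sc
      z₀ : Chain n
      z₀ = z ⊕ ∂ (ε v c)
      cz₀ : Cycle W z₀
      cz₀ = Cycle-⊕ cz (Cycle-∂ sεc)
      open ≡-Reasoning
      ιz₀ : ι v z₀ ≡ 𝟘
      ιz₀ = begin
        ι v (z ⊕ ∂ (ε v c))         ≡⟨ ι-⊕ v z _ ⟩
        ι v z ⊕ ι v (∂ (ε v c))     ≡⟨ cong (ι v z ⊕_) (ι-∂ v _) ⟩
        ι v z ⊕ ∂ (ι v (ε v c))     ≡⟨ cong (λ u → ι v z ⊕ ∂ u) (ι-ε-vanish v (ι-vanish-lk {W} v sc)) ⟩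
        ι v z ⊕ ∂ c                 ≡⟨ cong (ι v z ⊕_) eq ⟩
        ι v z ⊕ ι v z               ≡⟨ ⊕-self _ ⟩
        𝟘                           ∎

    -- The connecting map followed by inclusion into the deletion is zero: the faces of `z` that
    -- avoid `v` fill the contraction.
    ι-bounds : ∀ {z} → Cycle W z → Bd B (ι v z)
    ι-bounds {z} cz@(cyc sz dz) = rest v z , Supp-rest v sz , (begin
      ∂ (z ⊕ ε v (ι v z))             ≡⟨ ∂-⊕ z _ ⟩
      ∂ z ⊕ ∂ (ε v (ι v z))           ≡⟨ cong₂ _⊕_ dz (∂-ε v _) ⟩
      𝟘 ⊕ (ι v z ⊕ ε v (∂ (ι v z)))   ≡⟨ ⊕-identityˡ _ ⟩
      ι v z ⊕ ε v (∂ (ι v z))         ≡⟨ cong (λ u → ι v z ⊕ ε v u) (closed (Cycle-ι v cz)) ⟩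
      ι v z ⊕ ε v 𝟘                   ≡⟨ cong (ι v z ⊕_) (ε-𝟘 v) ⟩
      ι v z ⊕ 𝟘                       ≡⟨ ⊕-identityʳ _ ⟩
      ι v z                           ∎)
      where open ≡-Reasoning

    deletion-bounds : ∀ {z} → Acyclic B → Cycle W z → Bd A (ι v z) → Bd W z
    deletion-bounds acB cz b with push cz b
    ... | z₀ , cz₀ , b₀ = Bd-cancelʳ b₀ (Bd-mono B⊑W (acB z₀ cz₀))

    -- A surviving class makes the map from link to deletion an isomorphism of lines, so the third
    -- group of the exact triangle vanishes.
    survive⇒Acyclic : ∀ {y} → Rank≤1 A → Rank≤1 B → W v ≡ true → Cycle A y → ¬ Bd B y → Acyclic W
    survive⇒Acyclic {y} pA pB Wv cy ny z cz = bd (pA (ι v z) y (Cycle-ι v cz) cy)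
      where
      from : Bd A (ι v z) → Bd W z
      from b with push cz b
      ... | z₀ , cz₀ , b₀ with pB z₀ y cz₀ (Cycle-mono A⊑B cy)
      ...   | inj₁ p        = Bd-cancelʳ b₀ (Bd-mono B⊑W p)
      ...   | inj₂ (inj₁ p) = contradiction p ny
      ...   | inj₂ (inj₂ p) = Bd-cancelʳ b₀ (Bd-cancelʳ (Bd-mono B⊑W p) (cone Wv cy))
      bd : Bd A (ι v z) ⊎ Bd A y ⊎ Bd A (ι v z ⊕ y) → Bd W z
      bd (inj₁ p)        = from p
      bd (inj₂ (inj₁ p)) = contradiction (Bd-mono A⊑B p) ny
      bd (inj₂ (inj₂ p)) = contradiction (Bd-cancelˡ (Bd-mono A⊑B p) (ι-bounds cz)) ny

    -- If the class `y` of the link dies in the deletion, its lift and the class `b` would be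
    -- independent in the homology of `W`. So it survives, and `survive⇒Acyclic` applies.
    both⇒Acyclic : Rank≤1 W → Rank≤1 A → Rank≤1 B → W v ≡ true → NonAcyclic A → NonAcyclic B → Acyclic W
    both⇒Acyclic pW pA pB Wv (y , cy , ny) (b , cb , nb) with Bd? B y
    ... | no ¬q = survive⇒Acyclic pA pB Wv cy ¬q
    ... | yes (x₀ , s₀ , eq) with lift Wv cy s₀ eq
    ...   | cx , ιx with pW b (x₀ ⊕ ε v y) (Cycle-mono B⊑W cb) cx
    ...     | inj₂ (inj₁ p) = contradiction (subst (Bd A) ιx (Bd-ι v p)) ny
    ...     | inj₂ (inj₂ p) = contradiction (subst (Bd A) eq′ (Bd-ι v p)) ny
      where
      eq′ : ι v (b ⊕ (x₀ ⊕ ε v y)) ≡ y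
      eq′ = trans (ι-⊕ v b _) (trans (cong₂ _⊕_ (ι-vanish {W} v (supp cb)) ιx) (⊕-identityˡ y))
    ...     | inj₁ p with split-cycle cb p
    ...       | c₁ , cc₁ , back with pA c₁ y cc₁ cy
    ...         | inj₁ q        = contradiction (back (Bd-mono A⊑B q)) nb
    ...         | inj₂ (inj₁ q) = contradiction q ny
    ...         | inj₂ (inj₂ q) =
      contradiction (back (Bd-cancelʳ (Bd-mono A⊑B q) (x₀ , s₀ , eq))) nb

    total-link : ∀ {D} → NonAcyclicᵍ D W → Acyclic B → ∃ λ D′ → D ≡ suc D′ × NonAcyclicᵍ D′ A
    -- Contraction kills grade 0, so by exactness such a class would come from the acyclic deletion.
    total-link {zero} (z , cz , nz , hz) acB =
      contradiction (deletion-bounds acB cz (𝟘 , Supp-𝟘 , trans ∂-𝟘 (sym ιz))) nz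
      where
      ιz : ι v z ≡ 𝟘
      ιz = trans (cong (ι v) (sym hz)) (ι-π-zero v z)
    total-link {suc D} (z , cz , nz , hz) acB =
      D , refl , ι v z , Cycle-ι v cz , nz ∘ deletion-bounds acB cz ,
      trans (sym (ι-π v D z)) (cong (ι v) hz)

    deletion-link : ∀ {t} → Acyclic W → NonAcyclicᵍ t B → NonAcyclicᵍ t A
    deletion-link {t} acW (z , cz , nz , hz)
      with Bd-π t (acW z (Cycle-mono B⊑W cz)) hz
    ... | c , sc , eq , hc with split-boundary {z} {c} (ι-vanish {W} v (supp cz)) eq
    ...   | closed₁ , z≡ =
      ι v c , cyc (Supp-ι v sc) closed₁ ,
      (λ b → nz (subst (Bd B) (sym z≡) (Bd-⊕ (rest v c , Supp-rest v sc , refl) (Bd-mono A⊑B b)))) ,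
      trans (sym (ι-π v t c)) (cong (ι v) hc)

    link-total : ∀ {t} → W v ≡ true → NonAcyclicᵍ t A → Acyclic B → NonAcyclicᵍ (suc t) W
    link-total {t} Wv (y , cy , ny , hy) acB
      with Bd-π t (acB y (Cycle-mono A⊑B cy)) hy
    ... | x₀ , s₀ , eq , h₀ with lift Wv cy s₀ eq
    ...   | cx , ιx =
      x₀ ⊕ ε v y , cx , (λ b → ny (subst (Bd A) ιx (Bd-ι v b))) ,
      trans (π-⊕ (suc t) x₀ _) (cong₂ _⊕_ h₀ (trans (π-ε v t y) (cong (ε v) hy)))

    link-Acyclic : W v ≡ true → Acyclic W → Acyclic B → Acyclic A
    link-Acyclic Wv acW acB y cy with acB y (Cycle-mono A⊑B cy)
    ... | x₀ , s₀ , eq with lift Wv cy s₀ eq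
    ...   | cx , ιx = subst (Bd A) ιx (Bd-ι v (acW _ cx))

    link-Acyclic′ : Rank≤1 W → Rank≤1 A → Rank≤1 B → W v ≡ true → NonAcyclic W → NonAcyclic B → Acyclic A
    link-Acyclic′ pW pA pB Wv nW nB with status A
    ... | inj₁ ac = ac
    ... | inj₂ (_ , nA) = contradiction nW (Acyclic⇒¬NonAcyclic (both⇒Acyclic pW pA pB Wv (forget nA) nB))

    -- The link is acyclic by `link-Acyclic′`, so the inclusion of the deletion, which preserves
    -- grades, is injective on homology. For `v` outside `W` the two sets coincide.
    same-grade : ∀ {D t} → Rank≤1 W → Rank≤1 A → Rank≤1 B → NonAcyclicᵍ D W → NonAcyclicᵍ t B → D ≡ t
    same-grade {D} {t} pW pA pB nW nB@(b , cb , nb , hb) with W v in Wv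
    ... | true with Bd? W b
    ...   | no ¬q = Rank≤1-unique pW nW (b , Cycle-mono B⊑W cb , ¬q , hb)
    ...   | yes q with split-cycle cb q
    ...     | y , cy , back = contradiction (back (Bd-mono A⊑B
              (link-Acyclic′ pW pA pB Wv (forget nW) (forget nB) y cy))) nb
    same-grade {D} {t} pW pA pB nW nB@(b , cb , nb , hb) | false =
      Rank≤1-unique pB (NonAcyclicᵍ-resp W≗B nW) nB
      where
      W≗B : W ≗ B
      W≗B u with u Fin.≟ v
      ... | yes refl = trans Wv (sym (𝔹.∧-zeroʳ (W u)))
      ... | no _     = sym (𝔹.∧-identityʳ (W u))

-- Grades under successive deletions

module Minimal {n : ℕ} (G : Graph n) where
  open Complex G

  Hered : VSet n → Set
  Hered J = ∀ X → X ⊑ J → Rank≤1 X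

  Hered-⊑ : ∀ {J K} → K ⊑ J → Hered J → Hered K
  Hered-⊑ K⊑J h X X⊑K = h X (⊑-trans X⊑K K⊑J)

  private
    dl⊑ : ∀ (J : VSet n) v → J ⊓ dl v ⊑ J
    dl⊑ J v = ⊓-⊑ˡ {W = J} {dl v}

    lk⊑ : ∀ (J : VSet n) v → J ⊓ lk v ⊑ J
    lk⊑ J v = ⊓-⊑ˡ {W = J} {lk v}

  module _ {J : VSet n} (h : Hered J) where

    delete-same : ∀ {K D t} v → K ⊑ J → NonAcyclicᵍ D K → NonAcyclicᵍ t (K ⊓ dl v) → D ≡ t
    delete-same {K} v K⊑J = Triple.same-grade K v (h K K⊑J)
      (h _ (⊑-trans (lk⊑ K v) K⊑J)) (h _ (⊑-trans (dl⊑ K v) K⊑J))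

  -- A deletion between two sets with nonzero homology leaves the grade unchanged. What remains is
  -- the case where `J ⊓ dl y` and `J ⊝ Y` are both acyclic: passing to the link of `y` then lowers
  -- the grade of `J` by one and keeps that of `J ⊝ (y ∷ Y)`.
  grade-mono : ∀ {J} Y {D t} → Hered J → NonAcyclicᵍ D J → NonAcyclicᵍ t (J ⊝ Y) → t ≤ D
  grade-mono {J} [] h nJ nY = ℕₚ.≤-reflexive (Rank≤1-unique (h J λ _ e → e) nY nJ)
  grade-mono {J} (y ∷ Y) h nJ nY with status (J ⊓ dl y)
  ... | inj₂ (D′ , nJ′) with refl ← delete-same h y (λ _ e → e) nJ nJ′ =
    grade-mono Y (Hered-⊑ (dl⊑ J y) h) nJ′ (NonAcyclicᵍ-resp (sym ∘ ⊓-⊝ J (dl y) Y) nY)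
  ... | inj₁ aJ with status (J ⊝ Y)
  ...   | inj₂ (s , nJY) with refl ← delete-same h y (⊝-⊑ Y) nJY nY = grade-mono Y h nJ nJY
  ...   | inj₁ aJY with Triple.total-link J y nJ aJ
  ...     | D′ , refl , nA = ℕₚ.m≤n⇒m≤1+n
    (grade-mono Y (Hered-⊑ (lk⊑ J y) h) nA
      (NonAcyclicᵍ-resp (sym ∘ ⊓-⊝ J (lk y) Y) (Triple.deletion-link (J ⊝ Y) y aJY nY)))

  -- Vertices are dropped from the list while the larger set still has homology. They cannot all be
  -- dropped, because a single deletion is acyclic, so the link step of `grade-mono` must happen,
  -- and it costs a grade.
  grade-strict : ∀ {J} y Y {D t} → Hered J → (∀ {a} → a ∈ y ∷ Y → Acyclic (J ⊓ dl a)) →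
    NonAcyclicᵍ D J → NonAcyclicᵍ t (J ⊝ (y ∷ Y)) → suc t ≤ D
  grade-strict {J} y Y h ac nJ nY with status (J ⊝ Y)
  grade-strict {J} y []       h ac nJ nY | inj₂ _ =
    contradiction (forget nY) (Acyclic⇒¬NonAcyclic (ac (here refl)))
  grade-strict {J} y (z ∷ Y)  h ac nJ nY | inj₂ (s , nJY)
    with refl ← delete-same h y (⊝-⊑ (z ∷ Y)) nJY nY = grade-strict z Y h (ac ∘ there) nJ nJY
  ... | inj₁ aJY with Triple.total-link J y nJ (ac (here refl))
  ...   | D′ , refl , nA = s≤s
    (grade-mono Y (Hered-⊑ (lk⊑ J y) h) nA
      (NonAcyclicᵍ-resp (sym ∘ ⊓-⊝ J (lk y) Y) (Triple.deletion-link (J ⊝ Y) y aJY nY)))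

  -- The link step at `y` costs one grade as in `grade-strict`. Inside that link every further
  -- deletion of one `a` is still acyclic, by the exact sequence of `y` in `J ⊓ dl a`, so
  -- `grade-strict` applies there and costs a second one.
  grade-gap : ∀ {J} y Y {D t} → Hered J → (∀ {a} → a ∈ y ∷ Y → Acyclic (J ⊓ dl a)) →
    (∀ {a b} → a ∈ y ∷ Y → b ∈ y ∷ Y → Acyclic (J ⊓ dl a ⊓ dl b)) →
    NonAcyclicᵍ D J → NonAcyclicᵍ t (J ⊝ (y ∷ Y)) → suc (suc t) ≤ D
  grade-gap {J} y Y h ac ac₂ nJ nY with status (J ⊝ Y)
  grade-gap {J} y []      h ac ac₂ nJ nY | inj₂ _ =
    contradiction (forget nY) (Acyclic⇒¬NonAcyclic (ac (here refl)))
  grade-gap {J} y (z ∷ Y) h ac ac₂ nJ nY | inj₂ (s , nJY)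
    with refl ← delete-same h y (⊝-⊑ (z ∷ Y)) nJY nY =
    grade-gap z Y h (ac ∘ there) (λ p q → ac₂ (there p) (there q)) nJ nJY
  grade-gap {J} y []      h ac ac₂ nJ nY | inj₁ aJ = contradiction (forget nJ) (Acyclic⇒¬NonAcyclic aJ)
  grade-gap {J} y (z ∷ Y) {t = t} h ac ac₂ nJ nY | inj₁ aJY
    with Triple.total-link J y nJ (ac (here refl))
  ... | D′ , refl , nA = s≤s
    (grade-strict z Y (Hered-⊑ (lk⊑ J y) h) ac′ nA
      (NonAcyclicᵍ-resp (sym ∘ ⊓-⊝ J (lk y) (z ∷ Y)) (Triple.deletion-link (J ⊝ (z ∷ Y)) y aJY nY)))
    where
    -- Otherwise deleting `y` would change nothing, although it turns an acyclic set into one that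
    -- is not.
    y∈ : (J ⊝ (z ∷ Y)) y ≡ true
    y∈ with (J ⊝ (z ∷ Y)) y in e
    ... | true  = refl
    ... | false = contradiction (forget nY) (Acyclic⇒¬NonAcyclic (Acyclic-resp same aJY))
      where
      same : J ⊝ (z ∷ Y) ≗ J ⊝ (y ∷ z ∷ Y)
      same u with u Fin.≟ y
      ... | yes refl = trans e (sym (𝔹.∧-zeroʳ _))
      ... | no  _    = sym (𝔹.∧-identityʳ _)
    ac′ : ∀ {a} → a ∈ z ∷ Y → Acyclic (J ⊓ lk y ⊓ dl a)
    ac′ {a} a∈ = Acyclic-resp (⊓-swap J (dl a) (lk y))
      (Triple.link-Acyclic (J ⊓ dl a) y (⊝-∈-≢ y∈ a∈) (ac (there a∈)) (ac₂ (there a∈) (here refl)))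

  -- Minimal vertex sets with homology of dimension at least two

  module Critical (W : VSet n) (h : ∀ X → X ⊑ W → ∀ v → W v ≡ true → X v ≡ false → Rank≤1 X)
                  (¬pW : ¬ Rank≤1 W) where

    module T (v : Fin n) = Triple W v

    pB : ∀ {v} → W v ≡ true → Rank≤1 (W ⊓ dl v)
    pB {v} Wv = h _ (dl⊑ W v) v Wv (⊓-falseʳ {W = W} {dl v} (dl-self v))

    pA : ∀ {v} → W v ≡ true → Rank≤1 (W ⊓ lk v)
    pA {v} Wv = h _ (lk⊑ W v) v Wv (⊓-falseʳ {W = W} {lk v} (lk-self v))

    hered : ∀ {v} → W v ≡ true → Hered (W ⊓ dl v)
    hered {v} Wv X p = h X (⊑-trans p (dl⊑ W v)) v Wv (p v (⊓-falseʳ {W = W} {dl v} (dl-self v)))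

    ¬Acyclic : ¬ Acyclic W
    ¬Acyclic ac = ¬pW λ z w cz cw → inj₁ (ac z cz)

    abstract
      -- If the link were acyclic, every class of `W` would come from `W − v`, whose homology has
      -- dimension at most 1.
      nA : ∀ {v} → W v ≡ true → ∃ λ t → NonAcyclicᵍ t (W ⊓ lk v)
      nA {v} Wv with status (W ⊓ lk v)
      ... | inj₂ p  = p
      ... | inj₁ ac = ⊥-elim (¬pW p)
        where
        p : Rank≤1 W
        p z w cz cw
          with T.push v cz (ac _ (Cycle-ι v cz)) | T.push v cw (ac _ (Cycle-ι v cw))
        ... | z₀ , cz₀ , bz | w₀ , cw₀ , bw with pB Wv z₀ w₀ cz₀ cw₀
        ...   | inj₁ q        = inj₁ (Bd-cancelʳ bz (Bd-mono (dl⊑ W v) q))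
        ...   | inj₂ (inj₁ q) = inj₂ (inj₁ (Bd-cancelʳ bw (Bd-mono (dl⊑ W v) q)))
        ...   | inj₂ (inj₂ q) = inj₂ (inj₂ (Bd-cancelʳ
                  (subst (Bd W) (⊕-interchange z z₀ w w₀) (Bd-⊕ bz bw)) (Bd-mono (dl⊑ W v) q)))

    abstract
      -- If the deletion were acyclic, contraction would embed the homology of `W` into that of the
      -- link, of dimension at most 1.
      nB : ∀ {v} → W v ≡ true → ∃ λ t → NonAcyclicᵍ t (W ⊓ dl v)
      nB {v} Wv with status (W ⊓ dl v)
      ... | inj₂ p  = p
      ... | inj₁ ac = ⊥-elim (¬pW p)
        where
        p : Rank≤1 W
        p z w cz cw with pA Wv (ι v z) (ι v w) (Cycle-ι v cz) (Cycle-ι v cw)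
        ... | inj₁ q        = inj₁ (T.deletion-bounds v ac cz q)
        ... | inj₂ (inj₁ q) = inj₂ (inj₁ (T.deletion-bounds v ac cw q))
        ... | inj₂ (inj₂ q) = inj₂ (inj₂ (T.deletion-bounds v ac (Cycle-⊕ cz cw)
                  (subst (Bd (W ⊓ lk v)) (sym (ι-⊕ v z w)) q)))

    abstract
      -- A surviving class would make `W` acyclic. So the map from link to deletion is zero, and the
      -- homology of `W − v` embeds into that of `W`.
      link-dies : ∀ {v y} → W v ≡ true → Cycle (W ⊓ lk v) y → Bd (W ⊓ dl v) y
      link-dies {v} {y} Wv cy with Bd? (W ⊓ dl v) y
      ... | yes p = p
      ... | no ¬p = contradiction (T.survive⇒Acyclic v (pA Wv) (pB Wv) Wv cy ¬p) ¬Acyclic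

    deletion-injective : ∀ {v b} → W v ≡ true → Cycle (W ⊓ dl v) b → Bd W b → Bd (W ⊓ dl v) b
    deletion-injective {v} Wv cb p with T.split-cycle v cb p
    ... | y , cy , back = back (link-dies Wv cy)

    -- Since `v` lies in N[u], its removal does not change the link of `u`. In the sequence of `u`
    -- in `W − v`, whole and link are therefore nonzero, which forces the deletion to vanish.
    edge-Acyclic : ∀ {u v} → W u ≡ true → W v ≡ true → adj G u v ≡ true → Acyclic (W ⊓ dl v ⊓ dl u)
    edge-Acyclic {u} {v} Wu Wv uv with status (W ⊓ dl v ⊓ dl u)
    ... | inj₁ ac = ac
    ... | inj₂ (_ , n₂) = contradiction (forget (proj₂ (nA Wu))) (Acyclic⇒¬NonAcyclic (Acyclic-resp same
        (Triple.link-Acyclic′ (W ⊓ dl v) u (pB Wv)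
          (hered Wv _ (lk⊑ (W ⊓ dl v) u)) (hered Wv _ (dl⊑ (W ⊓ dl v) u))
          (⊓-true⁺ {W = W} {dl v} Wu (dl-≢ (adj-≢ uv))) (forget (proj₂ (nB Wv))) (forget n₂))))
      where
      same : W ⊓ dl v ⊓ lk u ≗ W ⊓ lk u
      same w with w Fin.≟ v
      ... | no  _    = cong (_∧ lk u w) (𝔹.∧-identityʳ (W w))
      ... | yes refl rewrite lk-adj uv = trans (𝔹.∧-zeroʳ _) (sym (𝔹.∧-zeroʳ (W w)))

    -- The same sequence, now with its acyclic deletion: contraction by `u` is an isomorphism that
    -- lowers the grade by one.
    edge-grade : ∀ {u v D t} → W u ≡ true → W v ≡ true → adj G u v ≡ true →
      NonAcyclicᵍ D (W ⊓ dl v) → NonAcyclicᵍ t (W ⊓ lk u) → D ≡ suc t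
    edge-grade {u} {v} Wu Wv uv nD nt = Rank≤1-unique (pB Wv) nD
      (Triple.link-total (W ⊓ dl v) u (⊓-true⁺ {W = W} {dl v} Wu (dl-≢ (adj-≢ uv)))
        (NonAcyclicᵍ-resp same nt) (edge-Acyclic Wu Wv uv))
      where
      same : W ⊓ lk u ≗ W ⊓ dl v ⊓ lk u
      same w with w Fin.≟ v
      ... | no  _    = cong (_∧ lk u w) (sym (𝔹.∧-identityʳ (W w)))
      ... | yes refl rewrite lk-adj uv = trans (𝔹.∧-zeroʳ (W w)) (sym (𝔹.∧-zeroʳ _))

    nbrs : Fin n → List (Fin n)
    nbrs v = filter (λ u → (W u 𝔹.≟ true) ×-dec (adj G v u 𝔹.≟ true)) (allFin n)

    nbrs⁻ : ∀ {v u} → u ∈ nbrs v → W u ≡ true × adj G v u ≡ true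
    nbrs⁻ {v} p = proj₂ (∈-filter⁻ (λ u → (W u 𝔹.≟ true) ×-dec (adj G v u 𝔹.≟ true)) {xs = allFin n} p)

    nbrs⁺ : ∀ {v u} → W u ≡ true → adj G v u ≡ true → u ∈ nbrs v
    nbrs⁺ {v} p q = ∈-filter⁺ (λ u → (W u 𝔹.≟ true) ×-dec (adj G v u 𝔹.≟ true)) (∈-allFin _) (p , q)

    nbrs-link : ∀ v → W ⊓ lk v ≗ W ⊓ dl v ⊝ nbrs v
    nbrs-link v u with (W ⊓ dl v ⊝ nbrs v) u in e₁ | (W ⊓ lk v) u in e₂
    ... | true  | true  = refl
    ... | false | false = refl
    ... | false | true with ⊓-true {W = W} {lk v} e₂
    ...   | Wu , lu with ⊓-true {W = dl v} {λ w → not (adj G v w)} {u} lu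
    ...     | du , au with ⊝-false (nbrs v) e₁
    ...       | inj₁ f = contradiction (trans (sym f) (⊓-true⁺ {W = W} {dl v} {u} Wu du)) λ ()
    ...       | inj₂ f = contradiction (trans (sym au) (cong not (proj₂ (nbrs⁻ f)))) λ ()
    nbrs-link v u | true | false with ⊓-false {W = W} {lk v} e₂
    ... | inj₁ f = contradiction (trans (sym e₁)
                     (⊝-⊑ (nbrs v) u (⊓-falseˡ {W = W} {dl v} f))) λ ()
    ... | inj₂ f with ⊓-false {W = dl v} {λ w → not (adj G v w)} {u} f
    ...   | inj₁ g = contradiction (trans (sym e₁)
                     (⊝-⊑ (nbrs v) u (⊓-falseʳ {W = W} {dl v} g))) λ ()
    ...   | inj₂ g with W u in Wu
    ...     | false = contradiction (trans (sym e₁)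
                     (⊝-⊑ (nbrs v) u (⊓-falseˡ {W = W} {dl v} Wu))) λ ()
    ...     | true  = contradiction (trans (sym e₁) (⊝-∈ (nbrs⁺ Wu (𝔹.not-injective g)))) λ ()

    -- `W − N[v]` arises from `W − v` by deleting the neighbours of `v`, and `edge-Acyclic` supplies
    -- the single deletions. Without neighbours, link and deletion would coincide, and a nonzero
    -- class would have to die in its own set by `link-dies`.
    gap : ∀ {v D t} → W v ≡ true → NonAcyclicᵍ D (W ⊓ dl v) → NonAcyclicᵍ t (W ⊓ lk v) →
      (∃ λ u → W u ≡ true × adj G v u ≡ true) × suc t ≤ D ×
      ((∀ {a b} → a ∈ nbrs v → b ∈ nbrs v → Acyclic (W ⊓ dl v ⊓ dl a ⊓ dl b)) → suc (suc t) ≤ D)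
    gap {v} Wv nD nt with nbrs v | nbrs-link v | (λ {u} → nbrs⁻ {v} {u})
    ... | [] | same | _ =
      let (y , cy , ny , _) = NonAcyclicᵍ-resp same nt in
      contradiction (link-dies Wv (Cycle-mono (≗⇒⊑ (sym ∘ same)) cy)) ny
    ... | y ∷ Y | same | nb =
      (y , nb (here refl)) ,
      grade-strict y Y (hered Wv) ac nD (NonAcyclicᵍ-resp same nt) ,
      λ ac₂ → grade-gap y Y (hered Wv) ac ac₂ nD (NonAcyclicᵍ-resp same nt)
      where
      ac : ∀ {a} → a ∈ y ∷ Y → Acyclic (W ⊓ dl v ⊓ dl a)
      ac a∈ = edge-Acyclic (proj₁ (nb a∈)) Wv (trans (Graph.sym G _ v) (proj₂ (nb a∈)))

    -- The inequality "grade gap ≥ 1" at both ends of an edge uv is tight, because each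
    -- deletion grade is one more than the other link grade.
    ¬all-Acyclic : ∀ {v} → W v ≡ true →
      ¬ (∀ {a b} → a ∈ nbrs v → b ∈ nbrs v → Acyclic (W ⊓ dl v ⊓ dl a ⊓ dl b))
    ¬all-Acyclic {v} Wv ac₂ with nB Wv | nA Wv
    ... | D , nD | t , nt with gap Wv nD nt
    ...   | (u , Wu , vu) , _ , wide with nB Wu | nA Wu
    ...     | D′ , nD′ | t′ , nt′ = ℕₚ.<-irrefl refl (begin-strict
      suc t   <⟨ wide ac₂ ⟩
      D       ≡⟨ edge-grade Wu Wv (trans (Graph.sym G u v) vu) nD nt′ ⟩
      suc t′  ≤⟨ proj₁ (proj₂ (gap Wu nD′ nt′)) ⟩
      D′      ≡⟨ edge-grade Wv Wu vu nD′ nt ⟩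
      suc t   ∎)
      where open ℕₚ.≤-Reasoning

-- Arithmetic of three colours

next : Fin 3 → Fin 3
next zero             = suc zero
next (suc zero)       = suc (suc zero)
next (suc (suc zero)) = zero

next^ : ℕ → Fin 3 → Fin 3
next^ zero    c = c
next^ (suc k) c = next^ k (next c)

next³ : ∀ c → next (next (next c)) ≡ c
next³ zero             = refl
next³ (suc zero)       = refl
next³ (suc (suc zero)) = refl

next^-fixed : ∀ k {c} → next^ k c ≡ c → 3 ∣ k
next^-fixed zero eq = 3 ∣0
next^-fixed 1 {zero} ()
next^-fixed 1 {suc zero} ()
next^-fixed 1 {suc (suc zero)} ()
next^-fixed 2 {zero} ()
next^-fixed 2 {suc zero} ()
next^-fixed 2 {suc (suc zero)} ()
next^-fixed (suc (suc (suc k))) {c} eq =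
  ∣m∣n⇒∣m+n ∣-refl (next^-fixed k (trans (cong (next^ k) (sym (next³ c))) eq))

abstract
  two-colours : ∀ a b → a ≢ b → b ≡ next a ⊎ a ≡ next b
  two-colours = from-yes (Finₚ.all? λ a → Finₚ.all? λ b →
    ¬? (a Fin.≟ b) →-dec ((b Fin.≟ next a) ⊎-dec (a Fin.≟ next b)))

abstract
  three-colours : ∀ c a b → a ≢ c → b ≢ c → a ≢ b → a ≡ next c ⊎ b ≡ next c
  three-colours = from-yes (Finₚ.all? λ c → Finₚ.all? λ a → Finₚ.all? λ b →
    ¬? (a Fin.≟ c) →-dec (¬? (b Fin.≟ c) →-dec (¬? (a Fin.≟ b) →-dec
    ((a Fin.≟ next c) ⊎-dec (b Fin.≟ next c)))))

-- Shortest directed closed walks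

module Oriented {n : ℕ} (G : Graph n) (W : VSet n) (col : Fin n → Fin 3)
  (proper : ∀ {u v} → W u ≡ true → W v ≡ true → adj G u v ≡ true → col u ≢ col v) where

  infix 4 _⇒_
  record _⇒_ (u v : Fin n) : Set where
    constructor arc
    field
      tail   : W u ≡ true
      head   : W v ≡ true
      edge   : adj G u v ≡ true
      colour : col v ≡ next (col u)
  open _⇒_

  data Walk : Fin n → Fin n → ℕ → Set where
    stop : ∀ {v} → Walk v v 0
    step : ∀ {u v w k} → u ⇒ v → Walk v w k → Walk u w (suc k)

  infixr 5 _++ʷ_
  _++ʷ_ : ∀ {u v w k l} → Walk u v k → Walk v w l → Walk u w (k + l)
  stop     ++ʷ q = q
  step e p ++ʷ q = step e (p ++ʷ q)

  at : ∀ {u v k} → Walk u v k → ℕ → Fin n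
  at {u} _          zero    = u
  -- Past its end the walk stays at the last vertex, so that every position has a value.
  at {u} stop       (suc i) = u
  at     (step e p) (suc i) = at p i

  at-end : ∀ {u v k} (p : Walk u v k) → at p k ≡ v
  at-end stop       = refl
  at-end (step e p) = at-end p

  at-arc : ∀ {u v k} (p : Walk u v k) {i} → i < k → at p i ⇒ at p (suc i)
  at-arc (step e stop)        {zero}  _         = e
  at-arc (step e (step f p))  {zero}  _         = e
  at-arc (step e p)           {suc i} (s≤s i<k) = at-arc p i<k

  segment : ∀ (p : ℕ → Fin n) {k} → (∀ {i} → i < k → p i ⇒ p (suc i)) →
    ∀ i d → i + d ≤ k → Walk (p i) (p (i + d)) d
  segment p e i zero    le = subst (λ j → Walk (p i) (p j) 0) (sym (ℕₚ.+-identityʳ i)) stop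
  segment p {k} e i (suc d) le = step (e (ℕₚ.≤-trans (s≤s (ℕₚ.m≤m+n i d)) le′))
    (subst (λ j → Walk (p (suc i)) (p j) d) (sym (ℕₚ.+-suc i d)) (segment p e (suc i) d le′))
    where
    le′ : suc i + d ≤ k
    le′ = subst (_≤ k) (ℕₚ.+-suc i d) le

  walk-colour : ∀ {u v k} → Walk u v k → col v ≡ next^ k (col u)
  walk-colour stop               = refl
  walk-colour (step {k = k} e p) = trans (walk-colour p) (cong (next^ k) (colour e))

  orient : ∀ {u v} → W u ≡ true → W v ≡ true → adj G u v ≡ true → u ⇒ v ⊎ v ⇒ u
  orient {u} {v} Wu Wv uv with two-colours (col u) (col v) (proper Wu Wv uv)
  ... | inj₁ eq = inj₁ (arc Wu Wv uv eq)
  ... | inj₂ eq = inj₂ (arc Wv Wu (trans (Graph.sym G v u) uv) eq)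

  module _ {v k} (w : Walk v v k)
           (shortest : ∀ {u j} → suc j < k → ¬ Walk u u (suc j)) (0<k : 0 < k) where

    private
      p : ℕ → Fin n
      p = at w

      e : ∀ {i} → i < k → p i ⇒ p (suc i)
      e = at-arc w

    no-repeat : ∀ i d → i + suc d < k → p i ≢ p (i + suc d)
    no-repeat i d lt eq = shortest (ℕₚ.≤-<-trans (ℕₚ.m≤n+m (suc d) i) lt)
      (subst (λ x → Walk (p i) x (suc d)) (sym eq) (segment p e i (suc d) (ℕₚ.<⇒≤ lt)))

    -- The chord closes the segment that it spans to a closed walk of length `d + 2`. This is too
    -- short unless the segment is the whole walk without its last arc.
    back-chord : ∀ i d → i + suc d < k → p (i + suc d) ⇒ p i → i ≡ 0 × suc (i + suc d) ≡ k
    back-chord (suc i) d lt a = contradiction (step a (segment p e (suc i) (suc d) (ℕₚ.<⇒≤ lt)))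
      (shortest (ℕₚ.≤-<-trans (s≤s (ℕₚ.m≤n+m (suc d) i)) lt))
    back-chord zero d lt a with suc (suc d) ℕ.≟ k
    ... | yes eq = refl , eq
    ... | no  ne = contradiction (step a (segment p e 0 (suc d) (ℕₚ.<⇒≤ lt)))
      (shortest (ℕₚ.≤∧≢⇒< lt ne))

    -- The closed walk that takes the chord, goes on to the end and returns from the start to `p i`
    -- replaces `suc d` arcs by one.
    forward-chord : ∀ i d → i + suc d < k → p i ⇒ p (i + suc d) → d ≡ 0
    forward-chord i zero    lt a = refl
    forward-chord i (suc d) lt a with ℕₚ.m≤n⇒∃[o]m+o≡n (ℕₚ.<⇒≤ lt)
    ... | r , eq = contradiction
      (step a (subst (λ x → Walk (p j) x r) end (segment p e j r (ℕₚ.≤-reflexive eq)) ++ʷ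
               segment p e 0 i (ℕₚ.≤-trans (ℕₚ.m≤m+n i (suc (suc d))) (ℕₚ.<⇒≤ lt))))
      (shortest (subst (suc (r + i) <_) eq (begin-strict
        suc (r + i)           <⟨ ℕₚ.n<1+n _ ⟩
        2 + (r + i)           ≤⟨ s≤s (s≤s (ℕₚ.m≤n+m (r + i) d)) ⟩
        2 + (d + (r + i))     ≡⟨ cong (λ m → 2 + (d + m)) (ℕₚ.+-comm r i) ⟩
        2 + (d + (i + r))     ≡⟨ ℕₚ.+-assoc (2 + d) i r ⟨
        2 + d + i + r         ≡⟨ cong (_+ r) (ℕₚ.+-comm (2 + d) i) ⟩
        i + (2 + d) + r       ∎)))
      where
      open ℕₚ.≤-Reasoning
      j : ℕ
      j = i + suc (suc d)
      end : p (j + r) ≡ p 0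
      end = trans (cong p eq) (at-end w)

    private
      chord : ∀ i d → i + suc d < k → adj G (p i) (p (i + suc d)) ≡ true →
        suc i ≡ i + suc d ⊎ suc (i + suc d) ≡ k × i ≡ 0
      chord i d lt a with orient (tail (e (ℕₚ.≤-<-trans (ℕₚ.m≤m+n i (suc d)) lt))) (tail (e lt)) a
      ... | inj₁ f with refl ← forward-chord i d lt f = inj₁ (sym (ℕₚ.+-comm i 1))
      ... | inj₂ b with back-chord i d lt b
      ...   | q , r = inj₂ (r , q)

      gap : ∀ {i j} → i < j → ∃ λ d → j ≡ i + suc d
      gap {i} lt with ℕₚ.m≤n⇒∃[o]m+o≡n lt
      ... | d , eq = d , trans (sym eq) (sym (ℕₚ.+-suc i d))

      consecutive : ∀ {i j} → j < k → suc i ≡ j → adj G (p i) (p j) ≡ true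
      consecutive lt refl = edge (e (ℕₚ.<-trans (ℕₚ.n<1+n _) lt))

      wrap : ∀ {i} → suc i ≡ k → adj G (p i) (p 0) ≡ true
      wrap {i} refl = subst (λ x → adj G (p i) x ≡ true) (at-end w) (edge (e (ℕₚ.n<1+n i)))

      flip-adj : ∀ {a b} → adj G a b ≡ true → adj G b a ≡ true
      flip-adj {a} {b} = trans (Graph.sym G b a)

      triple : 3 ∣ k
      triple = next^-fixed k (sym (walk-colour w))

      vert : Fin k → Fin n
      vert i = p (Fin.toℕ i)

      inj : ∀ {i j} → vert i ≡ vert j → i ≡ j
      inj {i} {j} eq with ℕₚ.<-cmp (Fin.toℕ i) (Fin.toℕ j)
      ... | tri≈ _ q _ = Finₚ.toℕ-injective q
      ... | tri< lt _ _ with gap lt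
      ...   | d , q = contradiction (trans eq (cong p q))
                        (no-repeat _ d (subst (_< k) q (Finₚ.toℕ<n j)))
      inj {i} {j} eq | tri> _ _ lt with gap lt
      ...   | d , q = contradiction (trans (sym eq) (cong p q))
                        (no-repeat _ d (subst (_< k) q (Finₚ.toℕ<n i)))

      to : ∀ i j → adj G (vert i) (vert j) ≡ true → CycAdj k i j
      to i j a with ℕₚ.<-cmp (Fin.toℕ i) (Fin.toℕ j)
      ... | tri≈ _ q _ = contradiction
        (trans (sym a) (trans (cong (adj G (vert i)) (cong p (sym q))) (irrefl G _))) λ ()
      ... | tri< lt _ _ with gap lt
      ...   | d , q with chord _ d (subst (_< k) q (Finₚ.toℕ<n j))
                            (subst (λ m → adj G (vert i) (p m) ≡ true) q a)
      ...     | inj₁ r       = inj₁ (trans r (sym q))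
      ...     | inj₂ (r , s) = inj₂ (inj₂ (inj₂ (trans (cong suc q) r , s)))
      to i j a | tri> _ _ lt with gap lt
      ...   | d , q with chord _ d (subst (_< k) q (Finₚ.toℕ<n i))
                            (subst (λ m → adj G (vert j) (p m) ≡ true) q (flip-adj a))
      ...     | inj₁ r       = inj₂ (inj₁ (trans r (sym q)))
      ...     | inj₂ (r , s) = inj₂ (inj₂ (inj₁ (trans (cong suc q) r , s)))

      from : ∀ i j → CycAdj k i j → adj G (vert i) (vert j) ≡ true
      from i j (inj₁ q)               = consecutive (Finₚ.toℕ<n j) q
      from i j (inj₂ (inj₁ q))        = flip-adj (consecutive (Finₚ.toℕ<n i) q)
      from i j (inj₂ (inj₂ (inj₁ (q , r)))) =
        subst (λ m → adj G (vert i) (p m) ≡ true) (sym r) (wrap q)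
      from i j (inj₂ (inj₂ (inj₂ (q , r)))) =
        flip-adj (subst (λ m → adj G (vert j) (p m) ≡ true) (sym r) (wrap q))

    shortest-induced : 3 ∣ k × InducedCycle G k
    shortest-induced = triple , record
      { length≥3 = ∣⇒≤ {{ℕ.>-nonZero 0<k}} triple
      ; vert     = vert
      ; inj      = inj
      ; induced  = λ i j → mk⇔ (to i j) (from i j)
      }

  module _ (ternary : ∀ k → 3 ∣ k → ¬ InducedCycle G k) where

    -- By strong induction all shorter closed walks are excluded already, so the given one is itself
    -- shortest.
    no-closed-walk : ∀ k {v} → ¬ Walk v v (suc k)
    no-closed-walk = <-rec (λ k → ∀ {v} → ¬ Walk v v (suc k)) λ k rec w →
      let (d , c) = shortest-induced w (λ { (s≤s lt) → rec lt }) (s≤s z≤n) in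
      ternary _ d c

    module _ (forks : ∀ v → W v ≡ true → ∃ λ a → ∃ λ b →
                (W a ≡ true × adj G v a ≡ true) × (W b ≡ true × adj G v b ≡ true) × col a ≢ col b)
             (start : ∃ λ v → W v ≡ true) where

      private
        out : ∀ v → W v ≡ true → ∃ λ w → v ⇒ w
        out v Wv with forks v Wv
        ... | a , b , (Wa , va) , (Wb , vb) , a≢b with three-colours (col v) (col a) (col b)
                        (proper Wv Wa va ∘ sym) (proper Wv Wb vb ∘ sym) a≢b
        ...   | inj₁ eq = a , arc Wv Wa va eq
        ...   | inj₂ eq = b , arc Wv Wb vb eq

        path : ℕ → ∃ λ v → W v ≡ true
        path zero    = start
        path (suc i) = let (v , Wv) = path i ; (w , a) = out v Wv in w , head a

        p : ℕ → Fin n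
        p i = proj₁ (path i)

        arcs : ∀ {k i} → i < k → p i ⇒ p (suc i)
        arcs {i = i} _ = proj₂ (out (proj₁ (path i)) (proj₂ (path i)))

      no-forks : ⊥
      no-forks with Finₚ.pigeonhole (ℕₚ.n<1+n n) (λ i → p (Fin.toℕ i))
      ... | i , j , lt , eq with ℕₚ.m≤n⇒∃[o]m+o≡n lt
      ...   | d , q = no-closed-walk d
        (subst (λ x → Walk (p (Fin.toℕ i)) x (suc d))
          (trans (cong p (trans (ℕₚ.+-suc _ d) q)) (sym eq))
          (segment p arcs (Fin.toℕ i) (suc d) ℕₚ.≤-refl))

-- Colouring vertices by the nonzero classes of the homology plane

ι-all-zero : ∀ {n} (x y : Chain n) → (∀ u → ι u x ≡ 𝟘) → (∀ u → ι u y ≡ 𝟘) →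
  x ≡ 𝟘 ⊎ y ≡ 𝟘 ⊎ x ⊕ y ≡ 𝟘
ι-all-zero {zero} false y     p q = inj₁ refl
ι-all-zero {zero} true  false p q = inj₂ (inj₁ refl)
ι-all-zero {zero} true  true  p q = inj₂ (inj₂ refl)
ι-all-zero {suc n} (a , b) (c , d) p q
  with refl ← cong proj₁ (p zero) | refl ← cong proj₁ (q zero)
  with ι-all-zero a c (λ u → cong proj₁ (p (suc u))) (λ u → cong proj₁ (q (suc u)))
... | inj₁ refl        = inj₁ refl
... | inj₂ (inj₁ refl) = inj₂ (inj₁ refl)
... | inj₂ (inj₂ eq)   = inj₂ (inj₂ (cong₂ _,_ eq (⊕-self 𝟘)))

module Colouring {n : ℕ} (G : Graph n) (W : VSet n)
  (h : ∀ X → X ⊑ W → ∀ v → W v ≡ true → X v ≡ false → Complex.Rank≤1 G X)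
  (¬pW : ¬ Complex.Rank≤1 G W) where

  open Complex G
  open Cycle
  open Minimal G
  open Critical W h ¬pW

  module _ {r : Fin n} (Wr : W r ≡ true) where

    private
      b y x₀ x : Chain n
      b  = proj₁ (proj₂ (nB Wr))
      y  = proj₁ (proj₂ (nA Wr))
      cy : Cycle (W ⊓ lk r) y
      cy = proj₁ (proj₂ (proj₂ (nA Wr)))
      cb : Cycle (W ⊓ dl r) b
      cb = proj₁ (proj₂ (proj₂ (nB Wr)))
      nb : ¬ Bd (W ⊓ dl r) b
      nb = proj₁ (proj₂ (proj₂ (proj₂ (nB Wr))))
      ny : ¬ Bd (W ⊓ lk r) y
      ny = proj₁ (proj₂ (proj₂ (proj₂ (nA Wr))))
      x₀ = proj₁ (link-dies Wr cy)
      x  = x₀ ⊕ ε r y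
      lifted : Cycle W x × ι r x ≡ y
      lifted = T.lift r Wr cy (proj₁ (proj₂ (link-dies Wr cy))) (proj₂ (proj₂ (link-dies Wr cy)))

    -- The three nonzero classes: `b` spans the image of `W − r`, and `x` lifts the class `y` of the
    -- link of `r`.
    basis : Fin 3 → Chain n
    basis zero             = b
    basis (suc zero)       = x
    basis (suc (suc zero)) = x ⊕ b

    abstract
      -- Contraction by `r` sends `z` to 0 or to the class of `y`. In the second case `x` is added
      -- first; the rest comes from `W − r`, hence is 0 or `b`.
      spans : ∀ z → Cycle W z → ¬ Bd W z → ∃ λ i → Bd W (z ⊕ basis i)
      spans z cz nz with pA Wr (ι r z) y (Cycle-ι r cz) cy
      ... | inj₂ (inj₁ p) = contradiction p ny
      ... | inj₁ p with T.push r cz p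
      ...   | z₀ , cz₀ , bz with pB Wr z₀ b cz₀ cb
      ...     | inj₁ q        = contradiction (Bd-cancelʳ bz (Bd-mono (T.B⊑W r) q)) nz
      ...     | inj₂ (inj₁ q) = contradiction q nb
      ...     | inj₂ (inj₂ q) = zero , Bd-cancelʳ
        (subst (Bd W) (⊕-solve (z ∷ z₀ ∷ b ∷ []) ((v₀ ⊞ v₁) ⊞ nil) ((v₀ ⊞ v₂) ⊞ (v₁ ⊞ v₂)) refl)
          (Bd-⊕ bz (𝟘 , Supp-𝟘 , ∂-𝟘))) (Bd-mono (T.B⊑W r) q)
      spans z cz nz | inj₂ (inj₂ p)
        with T.push r (Cycle-⊕ cz (proj₁ lifted)) (subst (Bd (W ⊓ lk r))
               (sym (trans (ι-⊕ r z x) (cong (ι r z ⊕_) (proj₂ lifted)))) p)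
      ...   | z₀ , cz₀ , bz with pB Wr z₀ b cz₀ cb
      ...     | inj₁ q        = suc zero , Bd-cancelʳ bz (Bd-mono (T.B⊑W r) q)
      ...     | inj₂ (inj₁ q) = contradiction q nb
      ...     | inj₂ (inj₂ q) = suc (suc zero) , Bd-cancelʳ
        (subst (Bd W) (⊕-solve (z ∷ x ∷ z₀ ∷ b ∷ [])
          (((v₀ ⊞ v₁) ⊞ v₂) ⊞ nil) ((v₀ ⊞ (v₁ ⊞ v₃)) ⊞ (v₂ ⊞ v₃)) refl)
          (Bd-⊕ bz (𝟘 , Supp-𝟘 , ∂-𝟘))) (Bd-mono (T.B⊑W r) q)

    cycle : ∀ {v} → W v ≡ true → Chain n
    cycle Wv = proj₁ (proj₂ (nB Wv))

    cycle-in : ∀ {v} (Wv : W v ≡ true) → Cycle (W ⊓ dl v) (cycle Wv)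
    cycle-in Wv = proj₁ (proj₂ (proj₂ (nB Wv)))

    cycle-essential : ∀ {v} (Wv : W v ≡ true) → ¬ Bd W (cycle Wv)
    cycle-essential Wv p =
      proj₁ (proj₂ (proj₂ (proj₂ (nB Wv)))) (deletion-injective Wv (cycle-in Wv) p)

    abstract
      -- The index must not depend on the proof that `v` lies in `W`, although `cycle` does, so that
      -- proof is quantified inside. Vertices outside `W` get an arbitrary colour.
      class : ∀ v → ∃ λ i → ∀ Wv → Bd W (cycle {v} Wv ⊕ basis i)
      class v with W v 𝔹.≟ true
      ... | no  ¬p = zero , λ Wv → contradiction Wv ¬p
      ... | yes p with spans (cycle p) (Cycle-mono (T.B⊑W v) (cycle-in p)) (cycle-essential p)
      ...   | i , q = i , λ Wv → subst (λ e → Bd W (cycle e ⊕ basis i)) (≡-irrelevant p Wv) q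

    col : Fin n → Fin 3
    col v = proj₁ (class v)

    same-colour : ∀ {u v} (Wu : W u ≡ true) (Wv : W v ≡ true) → col u ≡ col v →
      Bd W (cycle Wu ⊕ cycle Wv)
    same-colour {u} {v} Wu Wv eq = subst (Bd W)
      (⊕-solve (cycle Wu ∷ cycle Wv ∷ basis (col v) ∷ []) ((v₀ ⊞ v₂) ⊞ (v₁ ⊞ v₂)) (v₀ ⊞ v₁) refl)
      (Bd-⊕ (subst (λ i → Bd W (cycle Wu ⊕ basis i)) eq (proj₂ (class u) Wu)) (proj₂ (class v) Wv))

    private
      -- The Mayer-Vietoris step. The faces of `c` through `v` form `cᵥ` and avoid `u`; the others
      -- form `c₀` and avoid `v`. Moving the two cycles by these boundaries gives one and the same
      -- cycle `m`, which therefore avoids both vertices and bounds.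
      separate : ∀ {u v c} → (Wu : W u ≡ true) (Wv : W v ≡ true) → u ≢ v →
        Acyclic (W ⊓ dl u ⊓ dl v) → Supp W c → ∂ c ≡ cycle Wu ⊕ cycle Wv → ι u (ι v c) ≡ 𝟘 → ⊥
      separate {u} {v} {c} Wu Wv u≢v ac sc dc ιc = cycle-essential Wu
        (subst (Bd W) (⊕-solve (cycle Wu ∷ ∂ cᵥ ∷ []) ((v₀ ⊞ v₁) ⊞ v₁) v₀ refl)
          (Bd-⊕ (Bd-mono (⊑-trans (⊓-⊑ˡ {W = W ⊓ dl u} {dl v}) (⊓-⊑ˡ {W = W} {dl u})) (ac m cm))
                (cᵥ , Supp-mono (T.B⊑W u) scᵥ , refl)))
        where
        cᵥ c₀ m : Chain n
        cᵥ = ε v (ι v c)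
        c₀ = rest v c
        m  = cycle Wu ⊕ ∂ cᵥ
        sc₀ : Supp (W ⊓ dl v) c₀
        sc₀ = Supp-rest v sc
        scᵥ : Supp (W ⊓ dl u) cᵥ
        scᵥ = Supp-dl u
          (subst (Supp W) (⊕-solve (c ∷ cᵥ ∷ []) (v₀ ⊞ (v₀ ⊞ v₁)) v₁ refl)
            (Supp-⊕ sc (Supp-mono (T.B⊑W v) sc₀)))
          (trans (ι-ε-comm u≢v _) (trans (cong (ε v) ιc) (ε-𝟘 v)))
        m≡ : m ≡ cycle Wv ⊕ ∂ c₀
        m≡ = begin
          cycle Wu ⊕ ∂ cᵥ
            ≡⟨ ⊕-solve (cycle Wu ∷ cycle Wv ∷ ∂ cᵥ ∷ []) (v₀ ⊞ v₂) (v₁ ⊞ ((v₀ ⊞ v₁) ⊞ v₂)) refl ⟩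
          cycle Wv ⊕ ((cycle Wu ⊕ cycle Wv) ⊕ ∂ cᵥ)
            ≡⟨ cong (λ t → cycle Wv ⊕ (t ⊕ ∂ cᵥ)) dc ⟨
          cycle Wv ⊕ (∂ c ⊕ ∂ cᵥ)
            ≡⟨ cong (cycle Wv ⊕_) (∂-⊕ c cᵥ) ⟨
          cycle Wv ⊕ ∂ c₀ ∎
          where open ≡-Reasoning
        cm-u : Cycle (W ⊓ dl u) m
        cm-u = Cycle-⊕ (cycle-in Wu) (Cycle-∂ scᵥ)
        ιm : ι v m ≡ 𝟘
        ιm = trans (cong (ι v) m≡)
          (ι-vanish {W} v (supp (Cycle-⊕ (cycle-in Wv) (Cycle-∂ sc₀))))
        cm : Cycle (W ⊓ dl u ⊓ dl v) m
        cm = cyc (Supp-dl v (supp cm-u) ιm) (closed cm-u)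

    -- Only faces of `c` through both vertices obstruct `separate`. For an edge there are none.
    -- Otherwise their contraction is a cycle of the common link, because each of the two given
    -- cycles misses one of the vertices; if `e` fills it, adding the boundary of v ∧ u ∧ e removes
    -- these faces and leaves `∂ c` as it is.
    colour-≢ : ∀ {u v} → W u ≡ true → W v ≡ true → u ≢ v → Acyclic (W ⊓ dl u ⊓ dl v) →
      adj G u v ≡ true ⊎ adj G v u ≡ false × Acyclic (W ⊓ lk v ⊓ lk u) → col u ≢ col v
    colour-≢ {u} {v} Wu Wv u≢v ac cond same with same-colour Wu Wv same
    colour-≢ {u} {v} Wu Wv u≢v ac (inj₁ uv) same | c , sc , dc =
      separate Wu Wv u≢v ac sc dc (proj₂ sc u v uv)
    colour-≢ {u} {v} Wu Wv u≢v ac (inj₂ (¬vu , ac₂)) same | c , sc , dc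
      with ac₂ (ι u (ι v c)) (cyc (Supp-ι u (Supp-ι v sc)) closed₁)
      where
      closed₁ : ∂ (ι u (ι v c)) ≡ 𝟘
      closed₁ = begin
        ∂ (ι u (ι v c))   ≡⟨ ι-∂ u _ ⟨
        ι u (∂ (ι v c))   ≡⟨ cong (ι u) (ι-∂ v c) ⟨
        ι u (ι v (∂ c))   ≡⟨ cong (ι u ∘ ι v) dc ⟩
        ι u (ι v (cycle Wu ⊕ cycle Wv))
          ≡⟨ cong (ι u) (trans (ι-⊕ v _ _) (trans (cong (ι v (cycle Wu) ⊕_)
               (ι-vanish {W} v (supp (cycle-in Wv)))) (⊕-identityʳ _))) ⟩
        ι u (ι v (cycle Wu)) ≡⟨ ι-comm u v _ ⟩
        ι v (ι u (cycle Wu)) ≡⟨ cong (ι v) (ι-vanish {W} u (supp (cycle-in Wu))) ⟩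
        ι v 𝟘                ≡⟨ ι-𝟘 v ⟩
        𝟘                    ∎
        where open ≡-Reasoning
    ... | e , se , de = separate Wu Wv u≢v ac (Supp-⊕ sc (Supp-∂ sf)) df ιf
      where
      f : Chain n
      f = ε v (ε u e)
      ιe : ι u e ≡ 𝟘
      ιe = ι-vanish-lk {W ⊓ lk v} u se
      ιve : ι v e ≡ 𝟘
      ιve = proj₁ se v (⊓-falseˡ {W = W ⊓ lk v} {lk u} (⊓-falseʳ {W = W} {lk v} (lk-self v)))
      u∈ : (W ⊓ lk v) u ≡ true
      u∈ = ⊓-true⁺ {W = W} {lk v} Wu (cong₂ _∧_ (dl-≢ u≢v) (cong not ¬vu))
      sf : Supp W f
      sf = Supp-ε v Wv (Supp-ε u u∈ se)
      df : ∂ (c ⊕ ∂ f) ≡ cycle Wu ⊕ cycle Wv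
      df = trans (∂-⊕ c _) (trans (cong (∂ c ⊕_) (∂∂ f)) (trans (⊕-identityʳ _) dc))
      open ≡-Reasoning
      ιf : ι u (ι v (c ⊕ ∂ f)) ≡ 𝟘
      ιf = begin
        ι u (ι v (c ⊕ ∂ f))               ≡⟨ cong (ι u) (ι-⊕ v c _) ⟩
        ι u (ι v c ⊕ ι v (∂ f))           ≡⟨ ι-⊕ u _ _ ⟩
        ι u (ι v c) ⊕ ι u (ι v (∂ f))     ≡⟨ cong (λ t → ι u (ι v c) ⊕ ι u t) (ι-∂ v f) ⟩
        ι u (ι v c) ⊕ ι u (∂ (ι v f))     ≡⟨ cong (ι u (ι v c) ⊕_) (ι-∂ u _) ⟩
        ι u (ι v c) ⊕ ∂ (ι u (ι v f))     ≡⟨ cong (λ t → ι u (ι v c) ⊕ ∂ (ι u t)) (ι-ε-vanish v ιvu) ⟩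
        ι u (ι v c) ⊕ ∂ (ι u (ε u e))     ≡⟨ cong (λ t → ι u (ι v c) ⊕ ∂ t) (ι-ε-vanish u ιe) ⟩
        ι u (ι v c) ⊕ ∂ e                 ≡⟨ cong (ι u (ι v c) ⊕_) de ⟩
        ι u (ι v c) ⊕ ι u (ι v c)         ≡⟨ ⊕-self _ ⟩
        𝟘                                 ∎
        where
        ιvu : ι v (ε u e) ≡ 𝟘
        ιvu = trans (ι-ε-comm (u≢v ∘ sym) e) (trans (cong (ε u) ιve) (ε-𝟘 u))

    proper : ∀ {u v} → W u ≡ true → W v ≡ true → adj G u v ≡ true → col u ≢ col v
    proper {u} {v} Wu Wv uv = colour-≢ Wu Wv (adj-≢ uv)
      (Acyclic-resp (⊓-swap W (dl v) (dl u)) (edge-Acyclic Wu Wv uv)) (inj₁ uv)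

    NonAcyclic? : ∀ X → Dec (NonAcyclic X)
    NonAcyclic? X with status X
    ... | inj₁ ac      = no (Acyclic⇒¬NonAcyclic ac)
    ... | inj₂ (_ , p) = yes (forget p)

    ¬NonAcyclic⇒Acyclic : ∀ {X} → ¬ NonAcyclic X → Acyclic X
    ¬NonAcyclic⇒Acyclic {X} ¬p with status X
    ... | inj₁ ac      = ac
    ... | inj₂ (_ , p) = contradiction (forget p) ¬p

    Fork : Fin n → Fin n → Fin n → Set
    Fork v a b = (W a ≡ true × adj G v a ≡ true) × (W b ≡ true × adj G v b ≡ true) ×
                 NonAcyclic (W ⊓ dl v ⊓ dl a ⊓ dl b)

    abstract
      fork : ∀ {v} → W v ≡ true → ∃ λ a → ∃ λ b → Fork v a b
      fork {v} Wv with Finₚ.any? (λ a → Finₚ.any? (λ b →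
        ((W a 𝔹.≟ true) ×-dec (adj G v a 𝔹.≟ true)) ×-dec
        (((W b 𝔹.≟ true) ×-dec (adj G v b 𝔹.≟ true)) ×-dec NonAcyclic? (W ⊓ dl v ⊓ dl a ⊓ dl b))))
      ... | yes p = p
      ... | no ¬p = contradiction
        (λ {a} {b} a∈ b∈ → ¬NonAcyclic⇒Acyclic λ q → ¬p (a , b , nbrs⁻ a∈ , nbrs⁻ b∈ , q)) (¬all-Acyclic Wv)

    private
      dl-absorb : ∀ X {a v} → adj G v a ≡ true → X ⊓ dl a ⊓ lk v ≗ X ⊓ lk v
      dl-absorb X {a} {v} va u with u Fin.≟ a
      ... | no  _    = cong (_∧ lk v u) (𝔹.∧-identityʳ (X u))
      ... | yes refl rewrite lk-adj va = trans (𝔹.∧-zeroʳ _) (sym (𝔹.∧-zeroʳ (X u)))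

    -- For nonadjacent `a` and `b` both conditions of `colour-≢` follow from exact triangles. In
    -- `K`, the link of `v` is that of `W` and the deletion of `v` is nonzero by the fork, so `K` is
    -- acyclic. Then the link of `b` in `W − a` is nonzero, and it is also the deletion of `a` from
    -- `L`, itself nonzero; so the link of `a` in `L` is acyclic.
    fork-colours : ∀ {v a b} → W v ≡ true → Fork v a b → col a ≢ col b
    fork-colours {v} {a} {b} Wv ((Wa , va) , (Wb , vb) , n₃) with adj G a b in ab
    ... | true  = proper Wa Wb ab
    ... | false = colour-≢ Wa Wb a≢b acAB (inj₂ (trans (Graph.sym G b a) ab , acL))
      where
      a≢b : a ≢ b
      a≢b refl = Acyclic⇒¬NonAcyclic (Acyclic-resp double (edge-Acyclic Wa Wv (trans (Graph.sym G a v) va))) n₃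
        where
        double : W ⊓ dl v ⊓ dl a ≗ W ⊓ dl v ⊓ dl a ⊓ dl a
        double u = trans (cong ((W ⊓ dl v) u ∧_) (sym (𝔹.∧-idem (dl a u))))
                         (sym (𝔹.∧-assoc ((W ⊓ dl v) u) (dl a u) (dl a u)))
      K : VSet n
      K = W ⊓ dl a ⊓ dl b
      K⊑ : K ⊑ W ⊓ dl a
      K⊑ = ⊓-⊑ˡ {W = W ⊓ dl a} {dl b}
      Kv : K v ≡ true
      Kv = ⊓-true⁺ {W = W ⊓ dl a} {dl b} (⊓-true⁺ {W = W} {dl a} Wv (dl-≢ (adj-≢ va))) (dl-≢ (adj-≢ vb))
      link : W ⊓ lk v ≗ K ⊓ lk v
      link u = sym (trans (dl-absorb (W ⊓ dl a) vb u) (dl-absorb W va u))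
      del : W ⊓ dl v ⊓ dl a ⊓ dl b ≗ K ⊓ dl v
      del u = trans (cong (_∧ dl b u) (⊓-swap W (dl v) (dl a) u)) (⊓-swap (W ⊓ dl a) (dl v) (dl b) u)
      NonAcyclic-resp : ∀ {X Y} → X ≗ Y → NonAcyclic X → NonAcyclic Y
      NonAcyclic-resp eq (z , cz , nz) =
        z , Cycle-mono (≗⇒⊑ eq) cz , nz ∘ Bd-mono (≗⇒⊑ (sym ∘ eq))
      acAB : Acyclic K
      acAB = Triple.both⇒Acyclic K v (hered Wa K K⊑)
        (hered Wa _ (⊑-trans (⊓-⊑ˡ {W = K} {lk v}) K⊑))
        (hered Wa _ (⊑-trans (⊓-⊑ˡ {W = K} {dl v}) K⊑)) Kv
        (NonAcyclic-resp link (forget (proj₂ (nA Wv)))) (NonAcyclic-resp del n₃)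
      L : VSet n
      L = W ⊓ lk b
      La : L a ≡ true
      La = ⊓-true⁺ {W = W} {lk b} Wa
        (cong₂ _∧_ (dl-≢ a≢b) (cong not (trans (Graph.sym G b a) ab)))
      nLa : NonAcyclic (L ⊓ dl a)
      nLa with Triple.total-link (W ⊓ dl a) b (proj₂ (nB Wa)) acAB
      ... | _ , _ , p = NonAcyclic-resp (⊓-swap W (dl a) (lk b)) (forget p)
      heredL : Hered L
      heredL X p = h X (⊑-trans p (⊓-⊑ˡ {W = W} {lk b})) b Wb
                     (p b (⊓-falseʳ {W = W} {lk b} (lk-self b)))
      acL : Acyclic (L ⊓ lk a)
      acL = Triple.link-Acyclic′ L a (pA Wb) (heredL _ (⊓-⊑ˡ {W = L} {lk a}))
        (heredL _ (⊓-⊑ˡ {W = L} {dl a})) La (forget (proj₂ (nA Wb))) nLa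

    not-ternary : ¬ (∀ k → 3 ∣ k → ¬ InducedCycle G k)
    not-ternary ternary = Oriented.no-forks G W col proper ternary forks (r , Wr)
      where
      forks : ∀ v → W v ≡ true → ∃ λ a → ∃ λ b →
        (W a ≡ true × adj G v a ≡ true) × (W b ≡ true × adj G v b ≡ true) × col a ≢ col b
      forks v Wv =
        let (a , b , f@(p , q , _)) = fork Wv in a , b , p , q , fork-colours Wv f

  absurd : ¬ (∀ k → 3 ∣ k → ¬ InducedCycle G k)
  absurd ternary with Finₚ.any? (λ v → W v 𝔹.≟ true)
  ... | yes (r , Wr) = not-ternary Wr ternary
  -- Without vertices the only chains are 0 and the empty face, so the dimension is at most 1; a
  -- minimal `W` therefore has a vertex.
  ... | no  empty    = ¬pW p
    where
    vanish : ∀ {z} → Cycle W z → ∀ u → ι u z ≡ 𝟘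
    vanish cz u with W u in e
    ... | true  = contradiction (u , e) empty
    ... | false = proj₁ (supp cz) u e
    zero-Bd : ∀ {z} → z ≡ 𝟘 → Bd W z
    zero-Bd refl = 𝟘 , Supp-𝟘 , ∂-𝟘
    p : Rank≤1 W
    p z w cz cw with ι-all-zero z w (vanish cz) (vanish cw)
    ... | inj₁ q        = inj₁ (zero-Bd q)
    ... | inj₂ (inj₁ q) = inj₂ (inj₁ (zero-Bd q))
    ... | inj₂ (inj₂ q) = inj₂ (inj₂ (zero-Bd q))

-- Reduction to a minimal vertex set

size : ∀ {n} → VSet n → ℕ
size W = ∣ Vec.tabulate W ∣

size-< : ∀ {n} {X W : VSet n} v → X ⊑ W → W v ≡ true → X v ≡ false → size X < size W
size-< {X = X} {W} v X⊑W Wv Xv = p⊂q⇒∣p∣<∣q∣ (sub , v , intro W Wv , λ p →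
   contradiction (trans (sym Xv) (elim X p)) λ ())
  where
  intro : ∀ (Y : VSet _) {u} → Y u ≡ true → Vec.tabulate Y Vec.[ u ]= true
  intro Y {u} e = lookup⇒[]= u _ (trans (lookup∘tabulate Y u) e)
  elim : ∀ (Y : VSet _) {u} → Vec.tabulate Y Vec.[ u ]= true → Y u ≡ true
  elim Y {u} e = trans (sym (lookup∘tabulate Y u)) ([]=⇒lookup e)
  sub : ∀ {u} → Vec.tabulate X Vec.[ u ]= true → Vec.tabulate W Vec.[ u ]= true
  sub {u} p with W u in e
  ... | true  = intro W e
  ... | false = contradiction (trans (sym (elim X p)) (X⊑W u e)) λ ()

ternary⇒Rank≤1 : ∀ {n} (G : Graph n) → (∀ k → 3 ∣ k → ¬ InducedCycle G k) → ∀ W → Complex.Rank≤1 G W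
ternary⇒Rank≤1 {n} G ternary W =
  <-rec (λ m → ∀ W → size W ≡ m → Rank≤1 W) step (size W) W refl
  where
  open Complex G
  step : ∀ m → (∀ {l} → l < m → ∀ X → size X ≡ l → Rank≤1 X) → ∀ W → size W ≡ m → Rank≤1 W
  step m rec W refl z w cz cw with Bd? W z | Bd? W w | Bd? W (z ⊕ w)
  ... | yes p | _     | _     = inj₁ p
  ... | no _  | yes p | _     = inj₂ (inj₁ p)
  ... | no _  | no _  | yes p = inj₂ (inj₂ p)
  ... | no ¬p | no ¬q | no ¬r = ⊥-elim (Colouring.absurd G W
    (λ X X⊑W v Wv Xv → rec (size-< v X⊑W Wv Xv) X refl) ¬pW ternary)
    where
    ¬pW : ¬ Rank≤1 W
    ¬pW pW with pW z w cz cw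
    ... | inj₁ p        = ¬p p
    ... | inj₂ (inj₁ q) = ¬q q
    ... | inj₂ (inj₂ r) = ¬r r

-- Determinants and elimination over 𝔽₂

-- det₂ is det modulo 2: the signs of altSum disappear.
expand : {C : Set} → (C → Bool) → (List C → Bool) → List C → Bool
expand e F []       = false
expand e F (c ∷ cs) = (e c ∧ F cs) xor expand e (F ∘ (c ∷_)) cs

det₂ : {R C : Set} → (R → C → Bool) → List R → List C → Bool
det₂ e []       []      = true
det₂ e []       (_ ∷ _) = false
det₂ e (r ∷ rs) cs      = expand (e r) (det₂ e rs) cs

xor-swap : ∀ a b c → a xor (b xor c) ≡ b xor (a xor c)
xor-swap true  true  c = refl
xor-swap true  false c = refl
xor-swap false true  c = refl
xor-swap false false c = refl

xor-cancel : ∀ a b → a xor (a xor b) ≡ b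
xor-cancel true  b = 𝔹.not-involutive b
xor-cancel false b = refl

xor-false : ∀ {a b} → a ≡ false → b ≡ false → a xor b ≡ false
xor-false refl refl = refl

xor-≡ : ∀ {a b} → a xor b ≡ false → a ≡ b
xor-≡ {true}  {true}  _ = refl
xor-≡ {false} {false} _ = refl

module _ {C : Set} (e : C → Bool) where

  expand-cong : ∀ {F H} cs → (∀ l → F l ≡ H l) → expand e F cs ≡ expand e H cs
  expand-cong []       eq = refl
  expand-cong (c ∷ cs) eq = cong₂ _xor_ (cong (e c ∧_) (eq cs)) (expand-cong cs (eq ∘ (c ∷_)))

  expand-zero : ∀ {F} cs → (∀ l → F l ≡ false) → expand e F cs ≡ false
  expand-zero []       eq = refl
  expand-zero (c ∷ cs) eq =
    xor-false (trans (cong (e c ∧_) (eq cs)) (𝔹.∧-zeroʳ (e c))) (expand-zero cs (eq ∘ (c ∷_)))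

  expand-↭ : ∀ {F} → (∀ {l m} → l ↭ m → F l ≡ F m) → ∀ {cs ds} → cs ↭ ds →
    expand e F cs ≡ expand e F ds
  expand-↭ inv refl       = refl
  expand-↭ inv (prep c p) = cong₂ _xor_ (cong (e c ∧_) (inv p)) (expand-↭ (inv ∘ prep c) p)
  expand-↭ {F} inv (swap {xs} {ys} c d p) = trans
    (xor-swap (e c ∧ F (d ∷ xs)) (e d ∧ F (c ∷ xs)) _)
    (cong₂ _xor_ (cong (e d ∧_) (inv (prep c p)))
      (cong₂ _xor_ (cong (e c ∧_) (inv (prep d p)))
        (trans (expand-↭ (inv ∘ prep c ∘ prep d) p)
               (expand-cong ys (λ l → inv (swap c d refl))))))
  expand-↭ inv (Perm.trans p q) = trans (expand-↭ inv p) (expand-↭ inv q)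

module _ {R C : Set} (e : R → C → Bool) where

  -- Without signs the determinant is symmetric in its columns, so a column list matters only up to
  -- order.
  det₂-↭ : ∀ rs {cs ds} → cs ↭ ds → det₂ e rs cs ≡ det₂ e rs ds
  det₂-↭ (r ∷ rs) p                = expand-↭ (e r) (det₂-↭ rs) p
  det₂-↭ []       refl             = refl
  det₂-↭ []       (prep _ _)       = refl
  det₂-↭ []       (swap _ _ _)     = refl
  det₂-↭ []       (Perm.trans p q) = trans (det₂-↭ [] p) (det₂-↭ [] q)

  -- The first two terms of the expansion cancel; each later minor still contains both copies.
  det₂-repeat : ∀ rs c cs → det₂ e rs (c ∷ c ∷ cs) ≡ false
  det₂-repeat []       c cs = refl
  det₂-repeat (r ∷ rs) c cs =
    trans (xor-cancel (e r c ∧ det₂ e rs (c ∷ cs)) _) (expand-zero (e r) cs (det₂-repeat rs c))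

  det₂-∈ : ∀ rs {c cs} → c ∈ cs → det₂ e rs (c ∷ cs) ≡ false
  det₂-∈ rs {c} c∈ with ∈-∃++ c∈
  ... | as , bs , refl =
    trans (det₂-↭ rs (prep c (shift c as bs))) (det₂-repeat rs c (as ++ bs))

insert-⊆ : ∀ {A : Set} {c : A} {xs ys} → xs ⊆ ys → c ∈ ys → c ∉ xs → ∃ λ zs → zs ⊆ ys × c ∷ xs ↭ zs
insert-⊆ (y ∷ʳ s)    (here refl) c∉ = _ , refl ∷ s , refl
insert-⊆ (y ∷ʳ s)    (there c∈)  c∉ =
  let (zs , t , p) = insert-⊆ s c∈ c∉ in zs , y ∷ʳ t , p
insert-⊆ (refl ∷ s)  (here refl) c∉ = contradiction (here refl) c∉
insert-⊆ {c = c} (_∷_ {x} refl s)  (there c∈)  c∉ =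
  let (zs , t , p) = insert-⊆ s c∈ (c∉ ∘ there) in
  x ∷ zs , refl ∷ t , Perm.trans (swap c x refl) (prep x p)

inner : {C : Set} → List C → (C → Bool) → (C → Bool) → Bool
inner []       f w = false
inner (c ∷ cs) f w = (f c ∧ w c) xor inner cs f w

inner-cong : ∀ {C : Set} (cs : List C) {f g v w : C → Bool} →
  (∀ {c} → c ∈ cs → f c ≡ g c) → (∀ {c} → c ∈ cs → v c ≡ w c) → inner cs f v ≡ inner cs g w
inner-cong []       p q = refl
inner-cong (c ∷ cs) p q =
  cong₂ _xor_ (cong₂ _∧_ (p (here refl)) (q (here refl))) (inner-cong cs (p ∘ there) (q ∘ there))

inner-zero : ∀ {C : Set} (cs : List C) {f w : C → Bool} → (∀ {c} → c ∈ cs → f c ∧ w c ≡ false) →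
  inner cs f w ≡ false
inner-zero []       p = refl
inner-zero (c ∷ cs) p = xor-false (p (here refl)) (inner-zero cs (p ∘ there))

inner-xor : ∀ {C : Set} (cs : List C) (f g w : C → Bool) →
  inner cs (λ c → f c xor g c) w ≡ inner cs f w xor inner cs g w
inner-xor []       f g w = refl
inner-xor (c ∷ cs) f g w = trans (cong₂ _xor_ (𝔹.∧-distribʳ-xor (w c) (f c) (g c)) (inner-xor cs f g w))
  (⊕-interchange {0} (f c ∧ w c) (g c ∧ w c) (inner cs f w) (inner cs g w))

inner-scale : ∀ {C : Set} (cs : List C) b (f w : C → Bool) →
  inner cs (λ c → b ∧ f c) w ≡ b ∧ inner cs f w
inner-scale cs true  f w = refl
inner-scale cs false f w = inner-zero cs (λ _ → refl)

module Elimination {R C : Set} (e : R → C → Bool) (cols : List C) where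

  -- Membership in the row span, stated through annihilators. This is the form in which it is
  -- applied to solutions of linear equations.
  Span : List R → (C → Bool) → Set
  Span rs f = ∀ w → (∀ {r} → r ∈ rs → inner cols (e r) w ≡ false) → inner cols f w ≡ false

  expand-inner : ∀ (g : C → Bool) (F : C → List C → Bool) w →
    (∀ l → inner cols (λ c → F c l) w ≡ false) →
    ∀ l → inner cols (λ c → expand g (F c) l) w ≡ false
  expand-inner g F w z []      = inner-zero cols (λ _ → refl)
  expand-inner g F w z (d ∷ l) = trans (inner-xor cols _ _ w) (xor-false
    (trans (inner-scale cols (g d) (λ c → F c l) w) (trans (cong (g d ∧_) (z l)) (𝔹.∧-zeroʳ (g d))))
    (expand-inner g (λ c → F c ∘ (d ∷_)) w (z ∘ (d ∷_)) l))

  -- As a function of its first column a determinant is linear in that column, hence a combination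
  -- of the rows. The case of no rows uses that `det₂` is 0 on lists of different lengths.
  minor-span : ∀ rs l → Span rs (λ c → det₂ e rs (c ∷ l))
  minor-span []       l w z = inner-zero cols (λ _ → refl)
  minor-span (r ∷ rs) l w z = trans (inner-xor cols _ _ w) (xor-false
    (trans (inner-cong cols (λ {c} _ → 𝔹.∧-comm (e r c) (det₂ e rs l)) (λ _ → refl))
      (trans (inner-scale cols (det₂ e rs l) (e r) w)
        (trans (cong (det₂ e rs l ∧_) (z (here refl))) (𝔹.∧-zeroʳ (det₂ e rs l)))))
    (expand-inner (e r) (λ c m → det₂ e rs (c ∷ m)) w
      (λ m → minor-span rs m w (z ∘ there)) l))

  record Pivots (rows : List R) : Set where
    field
      prows   : List R
      pcols   : List C
      prows⊆  : prows ⊆ rows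
      pcols⊆  : pcols ⊆ cols
      square  : length prows ≡ length pcols
      minor   : det₂ e prows pcols ≡ true
      spanned : ∀ {r} → r ∈ rows → Span prows (e r)

  -- A nonzero minor is bordered greedily. A new row either admits a column that keeps the minor
  -- nonzero, which is then not among the old ones, or lies in the span of the pivot rows.
  pivots : ∀ rows → Pivots rows
  pivots [] = record
    { prows = [] ; pcols = [] ; prows⊆ = [] ; pcols⊆ = minimum cols
    ; square = refl ; minor = refl ; spanned = λ () }
  pivots (r ∷ rows) with pivots rows
  ... | P with Any.any? (λ c → det₂ e (r ∷ Pivots.prows P) (c ∷ Pivots.pcols P) 𝔹.≟ true) cols
  ...   | yes some = extend (find some)
    where
    open Pivots P
    extend : (∃ λ c → c ∈ cols × det₂ e (r ∷ prows) (c ∷ pcols) ≡ true) → Pivots (r ∷ rows)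
    extend (c , c∈ , d) with insert-⊆ pcols⊆ c∈
      (λ c∈p → contradiction (trans (sym d) (det₂-∈ e (r ∷ prows) c∈p)) λ ())
    ... | ds , ds⊆ , perm = record
      { prows = r ∷ prows ; pcols = ds ; prows⊆ = refl ∷ prows⊆ ; pcols⊆ = ds⊆
      ; square = trans (cong suc square) (↭-length perm)
      ; minor = trans (sym (det₂-↭ e (r ∷ prows) perm)) d
      ; spanned = λ { (here refl) w z → z (here refl) ; (there r∈) w z → spanned r∈ w (z ∘ there) } }
  pivots (r ∷ rows) | P | no none = record
    { prows = prows ; pcols = pcols ; prows⊆ = r ∷ʳ prows⊆ ; pcols⊆ = pcols⊆
    ; square = square ; minor = minor
    ; spanned = λ { (here refl) → head ; (there r∈) → spanned r∈ } }
    where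
    open Pivots P
    -- Expanding the vanishing bordered minor along the row `r` isolates the entry at `c`, as its
    -- cofactor `minor` is 1; the other terms are minors covered by `minor-span`.
    vanish : ∀ {c} → c ∈ cols → e r c ≡ expand (e r) (λ l → det₂ e prows (c ∷ l)) pcols
    vanish {c} c∈ with det₂ e (r ∷ prows) (c ∷ pcols) in d
    ... | true  = contradiction (Any.map (λ { refl → d }) c∈) none
    ... | false = trans (sym (trans (cong (e r c ∧_) minor) (𝔹.∧-identityʳ (e r c)))) (xor-≡ d)
    head : Span prows (e r)
    head w z = trans (inner-cong cols vanish (λ _ → refl))
      (expand-inner (e r) (λ c l → det₂ e prows (c ∷ l)) w (λ m → minor-span prows m w z) pcols)

module _ {C : Set} (_≟_ : DecidableEquality C) where

  Solution : List C → List (C → Bool) → Set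
  Solution cols φs = ∃ λ w → (∃ λ c → c ∈ cols × w c ≡ true) × (∀ {φ} → φ ∈ φs → inner cols φ w ≡ false)

  -- Elimination: an equation `φ` that involves `c` is removed together with `c`, and the value at
  -- `c` is afterwards chosen to satisfy `φ`. If no equation involves `c`, the unit vector at `c` is
  -- a solution.
  kernel : ∀ cols φs → Unique cols → length φs < length cols → Solution cols φs
  kernel (c ∷ cols) φs (c∉ ∷ uniq) lt with Any.any? (λ φ → φ c 𝔹.≟ true) φs
  ... | no none = (λ a → does (a ≟ c)) , (c , here refl , dec-true (c ≟ c) refl) ,
                  λ {φ} φ∈ → inner-zero (c ∷ cols) {φ} (λ {a} _ → term φ∈ a)
    where
    term : ∀ {φ} → φ ∈ φs → ∀ a → φ a ∧ does (a ≟ c) ≡ false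
    term {φ} φ∈ a with a ≟ c
    ... | no  _    = 𝔹.∧-zeroʳ (φ a)
    ... | yes refl with φ a in eq
    ...   | false = refl
    ...   | true  = contradiction (Any.map (λ { refl → eq }) φ∈) none
  ... | yes some = use (split some)
    where
    split : ∀ {φs} → Any.Any (λ φ → φ c ≡ true) φs →
      ∃ λ φ → ∃ λ ψs → φ c ≡ true × φs ↭ φ ∷ ψs
    split {φ ∷ φs} (here p)  = φ , φs , p , refl
    split {ψ ∷ φs} (there p) = let (φ , ψs , q , r) = split p in
      φ , ψ ∷ ψs , q , Perm.trans (prep ψ r) (swap ψ φ refl)
    use : (∃ λ φ → ∃ λ ψs → φ c ≡ true × φs ↭ φ ∷ ψs) → Solution (c ∷ cols) φs
    use (φ , ψs , φc , perm) = answer (kernel cols (map reduce ψs) uniq bound)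
      where
      reduce : (C → Bool) → C → Bool
      reduce ψ a = ψ a xor (ψ c ∧ φ a)
      bound : length (map reduce ψs) < length cols
      bound = subst (_< length cols) (sym (length-map reduce ψs))
        (ℕₚ.≤-pred (subst (_< suc (length cols)) (↭-length perm) lt))
      answer : Solution cols (map reduce ψs) → Solution (c ∷ cols) φs
      answer (w , (d , d∈ , wd) , z) = w′ , (d , there d∈ , trans (off d∈) wd) ,
        λ χ∈ → solved (∈-resp χ∈)
        where
        w′ : C → Bool
        w′ a with a ≟ c
        ... | yes _ = inner cols φ w
        ... | no  _ = w a
        on : w′ c ≡ inner cols φ w
        on with c ≟ c
        ... | yes _  = refl
        ... | no c≢c = contradiction refl c≢c
        off : ∀ {a} → a ∈ cols → w′ a ≡ w a
        off {a} a∈ with a ≟ c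
        ... | yes refl = contradiction refl (All.lookup c∉ a∈)
        ... | no  _    = refl
        ∈-resp : ∀ {χ} → χ ∈ φs → χ ∈ φ ∷ ψs
        ∈-resp = ∈-resp-↭ perm
        solved : ∀ {χ} → χ ∈ φ ∷ ψs → inner (c ∷ cols) χ w′ ≡ false
        solved (here refl) = trans (cong₂ _xor_ (cong₂ _∧_ φc on) (inner-cong cols (λ _ → refl) off))
          (𝔹.xor-same (inner cols φ w))
        solved {χ} (there χ∈) = trans
          (cong₂ _xor_ (cong (χ c ∧_) on) (inner-cong cols (λ _ → refl) off))
          (trans (𝔹.xor-comm (χ c ∧ inner cols φ w) _)
            (trans (cong (inner cols χ w xor_) (sym (inner-scale cols (χ c) φ w)))
              (trans (sym (inner-xor cols χ (λ a → χ c ∧ φ a) w)) (z (∈-map⁺ reduce χ∈)))))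

-- Rational minors modulo two

-- An odd minor is nonzero, so ranks over 𝔽₂ bound the ranks over ℚ from below.
bit : Bool → ℤ
bit true  = + 1
bit false = + 0

-- An integer with its parity. Unnormalised fractions with denominator 1 reduce the ring operations
-- to integer identities.
record Residue (q : ℚ) (b : Bool) : Set where
  constructor _,_
  field
    half  : ℤ
    equal : toℚᵘ q ≃ mkℚᵘ (bit b ℤ.+ (half ℤ.+ half)) 0

residue-0 : Residue 0ℚ false
residue-0 = + 0 , *≡* refl

residue-1 : Residue 1ℚ true
residue-1 = + 0 , *≡* refl

private
  whole : ∀ {x y} → x ≡ y → mkℚᵘ x 0 ≃ mkℚᵘ y 0
  whole refl = ℚᵘₚ.≃-refl

bit-- : ∀ a b → ∃ λ m → bit a ℤ.- bit b ≡ bit (a xor b) ℤ.+ (m ℤ.+ m)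
bit-- true  true  = + 0 , refl
bit-- true  false = + 0 , refl
bit-- false true  = -[1+ 0 ] , refl
bit-- false false = + 0 , refl

bit-* : ∀ a b → bit a ℤ.* bit b ≡ bit (a ∧ b)
bit-* true  true  = refl
bit-* true  false = refl
bit-* false b     = refl

residue-- : ∀ {p q a b} → Residue p a → Residue q b → Residue (p ℚ.- q) (a xor b)
residue-- {p} {q} {a} {b} (k , pk) (l , ql) with bit-- a b
... | m , eq = k ℤ.- l ℤ.+ m ,
  ℚᵘₚ.≃-trans (ℚₚ.toℚᵘ-homo-+ p (ℚ.- q))
  (ℚᵘₚ.≃-trans (ℚᵘₚ.+-cong pk (ℚᵘₚ.≃-trans (ℚₚ.toℚᵘ-homo‿- q) (ℚᵘₚ.-‿cong ql)))
   (whole (trans (lemma₁ (bit a) (bit b) k l)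
          (trans (cong (ℤ._+ (k ℤ.- l ℤ.+ (k ℤ.- l))) eq) (lemma₂ (bit (a xor b)) k l m)))))
  where
  lemma₁ : ∀ x y k l → (x ℤ.+ (k ℤ.+ k)) ℤ.* + 1 ℤ.+ (ℤ.- (y ℤ.+ (l ℤ.+ l))) ℤ.* + 1 ≡
    (x ℤ.- y) ℤ.+ (k ℤ.- l ℤ.+ (k ℤ.- l))
  lemma₁ = ℤ-Solver.solve-∀
  lemma₂ : ∀ x k l m → x ℤ.+ (m ℤ.+ m) ℤ.+ (k ℤ.- l ℤ.+ (k ℤ.- l)) ≡
    x ℤ.+ (k ℤ.- l ℤ.+ m ℤ.+ (k ℤ.- l ℤ.+ m))
  lemma₂ = ℤ-Solver.solve-∀

residue-* : ∀ {p q a b} → Residue p a → Residue q b → Residue (p ℚ.* q) (a ∧ b)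
residue-* {p} {q} {a} {b} (k , pk) (l , ql) = h ,
  ℚᵘₚ.≃-trans (ℚₚ.toℚᵘ-homo-* p q)
  (ℚᵘₚ.≃-trans (ℚᵘₚ.*-cong pk ql)
   (whole (trans (lemma (bit a) (bit b) k l) (cong (ℤ._+ (h ℤ.+ h)) (bit-* a b)))))
  where
  h : ℤ
  h = bit a ℤ.* l ℤ.+ k ℤ.* bit b ℤ.+ (k ℤ.* l ℤ.+ k ℤ.* l)
  lemma : ∀ x y k l → (x ℤ.+ (k ℤ.+ k)) ℤ.* (y ℤ.+ (l ℤ.+ l)) ≡
    x ℤ.* y ℤ.+ ((x ℤ.* l ℤ.+ k ℤ.* y ℤ.+ (k ℤ.* l ℤ.+ k ℤ.* l)) ℤ.+
                 (x ℤ.* l ℤ.+ k ℤ.* y ℤ.+ (k ℤ.* l ℤ.+ k ℤ.* l)))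
  lemma = ℤ-Solver.solve-∀

residue-≢0 : ∀ {q} → Residue q true → isZeroℚ q ≡ false
residue-≢0 {q} (k , qk) = dec-false (q ℚₚ.≟ 0ℚ) λ { refl → odd k (zero-num qk) }
  where
  zero-num : ∀ {z} → toℚᵘ 0ℚ ≃ mkℚᵘ z 0 → z ≡ + 0
  zero-num {z} (*≡* eq) = trans (sym (ℤₚ.*-identityʳ z)) (sym eq)
  odd : ∀ k → + 1 ℤ.+ (k ℤ.+ k) ≢ + 0
  odd (+ n)    ()
  odd -[1+ n ] ()

-- Alternating signs vanish modulo 2. The condition on lengths keeps minors square: with no rows
-- left, `det` is 1 for any columns, but `det₂` is 1 only if no columns are left either.
residue-expand : ∀ {C : Set} (g : C × List C → ℚ) (e : C → Bool) (F : List C → Bool) cs →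
  (∀ c l → suc (length l) ≡ length cs → Residue (g (c , l)) (e c ∧ F l)) →
  Residue (altSum (map g (picks cs))) (expand e F cs)
residue-expand g e F []       h = residue-0
residue-expand g e F (c ∷ cs) h = residue-- (h c cs refl)
  (subst (λ l → Residue (altSum l) (expand e (F ∘ (c ∷_)) cs)) (map-∘ (picks cs))
    (residue-expand _ e (F ∘ (c ∷_)) cs (λ d l eq → h d (c ∷ l) (cong suc eq))))

module _ {R C : Set} (e : R → C → ℚ) (e₂ : R → C → Bool)
         (entry : ∀ r c → Residue (e r c) (e₂ r c)) where

  residue-det : ∀ rs cs → length rs ≡ length cs → Residue (det e rs cs) (det₂ e₂ rs cs)
  residue-det []       []       eq = residue-1
  residue-det (r ∷ rs) cs eq = residue-expand _ (e₂ r) (det₂ e₂ rs) cs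
    (λ c l eq′ → residue-* (entry r c) (residue-det rs l (ℕₚ.suc-injective (trans eq (sym eq′)))))

  choose-⊆ : ∀ {A : Set} {xs ys : List A} → xs ⊆ ys → xs ∈ choose (length xs) ys
  choose-⊆ []                         = here refl
  choose-⊆ {xs = []}     (y ∷ʳ s)     = here refl
  choose-⊆ {xs = x ∷ xs} (y ∷ʳ s)     = ∈-++⁺ʳ (map (y ∷_) (choose (length xs) _)) (choose-⊆ s)
  choose-⊆ {xs = x ∷ xs} (refl ∷ s)   = ∈-++⁺ˡ (∈-map⁺ (x ∷_) (choose-⊆ s))

  any-∈ : ∀ {A : Set} (p : A → Bool) {x xs} → x ∈ xs → p x ≡ true → any p xs ≡ true
  any-∈ p (here refl) px rewrite px = refl
  any-∈ p {xs = y ∷ _} (there x∈) px = trans (cong (p y ∨_) (any-∈ p x∈ px)) (𝔹.∨-zeroʳ (p y))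

  ≤-foldr-⊔ : ∀ (g : ℕ → ℕ) {k ks} → k ∈ ks → g k ≤ foldr _⊔_ 0 (map g ks)
  ≤-foldr-⊔ g (here refl)          = ℕₚ.m≤m⊔n _ _
  ≤-foldr-⊔ g {ks = l ∷ _} (there k∈) = ℕₚ.≤-trans (≤-foldr-⊔ g k∈) (ℕₚ.m≤n⊔m (g l) _)

  rank-≥ : ∀ {rows cols rs cs} → rs ⊆ rows → cs ⊆ cols → length rs ≡ length cs →
    det₂ e₂ rs cs ≡ true → length rs ≤ rank e rows cols
  rank-≥ {rows} {cols} {rs} {cs} rs⊆ cs⊆ sq d =
    subst (_≤ rank e rows cols) value (≤-foldr-⊔ term (∈-upTo⁺ (s≤s
      (subst (_≤ length cols) (sym sq) (Sublistₚ.length-mono-≤ cs⊆)))))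
    where
    nonzero : ℕ → Bool
    nonzero k = any (λ rs′ → any (λ cs′ → not (isZeroℚ (det e rs′ cs′))) (choose k cols)) (choose k rows)
    term : ℕ → ℕ
    term k = if nonzero k then k else 0
    value : term (length rs) ≡ length rs
    value = cong (λ b → if b then length rs else 0) (any-∈ _ (choose-⊆ rs⊆)
      (any-∈ _ (subst (λ k → cs ∈ choose k cols) (sym sq) (choose-⊆ cs⊆))
        (cong not (residue-≢0 (subst (Residue (det e rs cs)) d (residue-det rs cs sq))))))

-- Cells, coefficients and the boundary matrix

one : ∀ {n} → Chain n
one {zero}  = true
one {suc n} = one , 𝟘

bottom : ∀ {n} → Chain n → Bool
bottom {zero}  x       = x
bottom {suc n} (a , b) = bottom a

-- coef x σ is the coefficient of σ in x only when σ has no repeated vertex.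
cell : ∀ {n} → List (Fin n) → Chain n
cell []      = one
cell (v ∷ σ) = ε v (cell σ)

coef : ∀ {n} → Chain n → List (Fin n) → Bool
coef x []      = bottom x
coef x (v ∷ τ) = coef (ι v x) τ

bottom-⊕ : ∀ {n} (x y : Chain n) → bottom (x ⊕ y) ≡ bottom x xor bottom y
bottom-⊕ {zero}  x y = refl
bottom-⊕ {suc n} (a , _) (c , _) = bottom-⊕ a c

bottom-𝟘 : ∀ {n} → bottom {n} 𝟘 ≡ false
bottom-𝟘 {zero}  = refl
bottom-𝟘 {suc n} = bottom-𝟘 {n}

bottom-ε : ∀ {n} v (x : Chain n) → bottom (ε v x) ≡ false
bottom-ε {suc n} zero    (a , b) = bottom-𝟘 {n}
bottom-ε {suc n} (suc v) (a , b) = bottom-ε v a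

bottom-one : ∀ n → bottom {n} one ≡ true
bottom-one zero    = refl
bottom-one (suc n) = bottom-one n

bottom-π : ∀ {n} s (x : Chain n) → bottom (π (suc s) x) ≡ false
bottom-π {zero}  s x       = refl
bottom-π {suc n} s (a , b) = bottom-π s a

ι-one : ∀ {n} (v : Fin n) → ι v one ≡ 𝟘
ι-one zero    = refl
ι-one (suc v) = cong₂ _,_ (ι-one v) (ι-𝟘 v)

∂-one : ∀ n → ∂ {n} one ≡ 𝟘
∂-one zero    = refl
∂-one (suc n) = cong₂ _,_ (trans (⊕-identityʳ _) (∂-one n)) ∂-𝟘

π-one : ∀ n → π {n} 0 one ≡ one
π-one zero    = refl
π-one (suc n) = cong (_, 𝟘) (π-one n)

coef-⊕ : ∀ {n} τ (x y : Chain n) → coef (x ⊕ y) τ ≡ coef x τ xor coef y τ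
coef-⊕ []      x y = bottom-⊕ x y
coef-⊕ (v ∷ τ) x y = trans (cong (λ z → coef z τ) (ι-⊕ v x y)) (coef-⊕ τ _ _)

coef-𝟘 : ∀ {n} τ → coef {n} 𝟘 τ ≡ false
coef-𝟘 {n} []  = bottom-𝟘 {n}
coef-𝟘 (v ∷ τ) = trans (cong (λ z → coef z τ) (ι-𝟘 v)) (coef-𝟘 τ)

coef-ι : ∀ {n} {v : Fin n} {σ} x → v ∈ σ → ι v x ≡ 𝟘 → coef x σ ≡ false
coef-ι {σ = _ ∷ σ} x (here refl) eq = trans (cong (λ z → coef z σ) eq) (coef-𝟘 σ)
coef-ι {v = v} {σ = u ∷ σ} x (there v∈) eq =
  coef-ι (ι u x) v∈ (trans (ι-comm v u x) (trans (cong (ι u) eq) (ι-𝟘 u)))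

coef-ε : ∀ {n} {v : Fin n} τ x → v ∉ τ → coef (ε v x) τ ≡ false
coef-ε {v = v} []      x v∉ = bottom-ε v x
coef-ε {v = v} (u ∷ τ) x v∉ =
  trans (cong (λ z → coef z τ) (ι-ε-comm (λ { refl → v∉ (here refl) }) x)) (coef-ε τ _ (v∉ ∘ there))

coef-π : ∀ {n} σ s (x : Chain n) → length σ ≢ s → coef (π s x) σ ≡ false
coef-π []      zero    x ne = contradiction refl ne
coef-π []      (suc s) x ne = bottom-π s x
coef-π (v ∷ σ) zero    x ne = trans (cong (λ z → coef z σ) (ι-π-zero v x)) (coef-𝟘 σ)
coef-π (v ∷ σ) (suc s) x ne =
  trans (cong (λ z → coef z σ) (ι-π v s x)) (coef-π σ s (ι v x) (ne ∘ cong suc))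

ι-cell : ∀ {n} {v : Fin n} σ → v ∉ σ → ι v (cell σ) ≡ 𝟘
ι-cell {v = v} []      v∉ = ι-one v
ι-cell {v = v} (u ∷ σ) v∉ = trans (ι-ε-comm (λ { refl → v∉ (here refl) }) (cell σ))
  (trans (cong (ε u) (ι-cell σ (v∉ ∘ there))) (ε-𝟘 u))

π-cell : ∀ {n} (σ : List (Fin n)) → π (length σ) (cell σ) ≡ cell σ
π-cell {n} []  = π-one n
π-cell (v ∷ σ) = trans (π-ε v (length σ) (cell σ)) (cong (ε v) (π-cell σ))

Sorted : ∀ {n} → List (Fin n) → Set
Sorted = AllPairs Fin._<_

_≟ˢ_ : ∀ {n} → DecidableEquality (List (Fin n))
_≟ˢ_ = ≡-dec Fin._≟_

head-∉ : ∀ {n} {v : Fin n} {σ} → Sorted (v ∷ σ) → v ∉ σ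
head-∉ (lt ∷ _) v∈ = Finₚ.<-irrefl refl (All.lookup lt v∈)

-- In sorted lists the smaller of two different heads occurs in only one of the lists, and
-- contraction by it or multiplication with it then gives coefficient 0. With equal heads both are
-- removed.
coef-cell : ∀ {n} {ρ τ : List (Fin n)} → Sorted ρ → Sorted τ → coef (cell ρ) τ ≡ does (ρ ≟ˢ τ)
coef-cell {n} {[]}    {[]}    sρ sτ = bottom-one n
coef-cell {ρ = []}    {b ∷ τ} sρ sτ =
  trans (coef-ι {σ = b ∷ τ} one (here refl) (ι-one b)) (sym (dec-false ([] ≟ˢ (b ∷ τ)) λ ()))
coef-cell {ρ = a ∷ ρ} {[]}    sρ sτ =
  trans (bottom-ε a (cell ρ)) (sym (dec-false ((a ∷ ρ) ≟ˢ []) λ ()))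
coef-cell {ρ = a ∷ ρ} {b ∷ τ} sρ@(la ∷ sρ′) sτ@(lb ∷ sτ′) with Finₚ.<-cmp a b
... | tri< a<b _ _ = trans (coef-ε (b ∷ τ) (cell ρ) a∉)
    (sym (dec-false ((a ∷ ρ) ≟ˢ (b ∷ τ)) λ { refl → Finₚ.<-irrefl refl a<b }))
  where
  a∉ : a ∉ b ∷ τ
  a∉ (here refl) = Finₚ.<-irrefl refl a<b
  a∉ (there a∈)  = Finₚ.<-asym a<b (All.lookup lb a∈)
... | tri> _ _ b<a = trans (coef-ι {σ = b ∷ τ} (cell (a ∷ ρ)) (here refl) (ι-cell (a ∷ ρ) b∉))
    (sym (dec-false ((a ∷ ρ) ≟ˢ (b ∷ τ)) λ { refl → Finₚ.<-irrefl refl b<a }))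
  where
  b∉ : b ∉ a ∷ ρ
  b∉ (here refl) = Finₚ.<-irrefl refl b<a
  b∉ (there b∈)  = Finₚ.<-asym b<a (All.lookup la b∈)
... | tri≈ _ refl _ = trans
    (cong (λ z → coef z τ) (trans (ι-ε a (cell ρ)) (trans (cong (λ z → cell ρ ⊕ ε a z) (ι-cell ρ (head-∉ sρ)))
      (trans (cong (cell ρ ⊕_) (ε-𝟘 a)) (⊕-identityʳ _)))))
    (trans (coef-cell sρ′ sτ′) (does-⇔ (mk⇔ (cong (a ∷_)) (proj₂ ∘ ∷-injective)) (ρ ≟ˢ τ) ((a ∷ ρ) ≟ˢ (a ∷ τ))))

subsets-sorted : ∀ n {σ} → σ ∈ subsets n → Sorted σ
subsets-sorted zero    (here refl) = []
subsets-sorted (suc n) σ∈ with ∈-++⁻ (map (map suc) (subsets n)) σ∈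
... | inj₁ p with ∈-map⁻ (map suc) p
...   | τ , τ∈ , refl = AllPairsₚ.map⁺ (AllPairs.map s≤s (subsets-sorted n τ∈))
subsets-sorted (suc n) σ∈ | inj₂ p with ∈-map⁻ (λ σ → zero ∷ map suc σ) p
...   | τ , τ∈ , refl = Allₚ.map⁺ (All.universal (λ _ → s≤s z≤n) τ) ∷
        AllPairsₚ.map⁺ (AllPairs.map s≤s (subsets-sorted n τ∈))

subsets-unique : ∀ n → Unique (subsets n)
subsets-unique zero    = [] ∷ []
subsets-unique (suc n) = Uniqueₚ.++⁺
  (Uniqueₚ.map⁺ (map-injective Finₚ.suc-injective) (subsets-unique n))
  (Uniqueₚ.map⁺ (λ eq → map-injective Finₚ.suc-injective (proj₂ (∷-injective eq))) (subsets-unique n))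
  λ (p , q) → disjoint (∈-map⁻ (map suc) p) (∈-map⁻ (λ σ → zero ∷ map suc σ) q)
  where
  disjoint : ∀ {σ} → (∃ λ τ → τ ∈ subsets n × σ ≡ map suc τ) →
    (∃ λ τ → τ ∈ subsets n × σ ≡ zero ∷ map suc τ) → ⊥
  disjoint ([] , _ , refl)    (_ , _ , ())
  disjoint (_ ∷ _ , _ , refl) (_ , _ , ())

lin : ∀ {n} → List (List (Fin n)) → (List (Fin n) → Bool) → Chain n
lin []       w = 𝟘
lin (σ ∷ S)  w = w σ · cell σ ⊕ lin S w

lin-++ : ∀ {n} (S T : List (List (Fin n))) w → lin (S ++ T) w ≡ lin S w ⊕ lin T w
lin-++ []      T w = sym (⊕-identityˡ _)
lin-++ (σ ∷ S) T w = trans (cong (w σ · cell σ ⊕_) (lin-++ S T w)) (sym (⊕-assoc _ _ _))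

lin-zero : ∀ {n} (S : List (List (Fin n))) {w} → (∀ {σ} → σ ∈ S → w σ ≡ false) → lin S w ≡ 𝟘
lin-zero []      z = refl
lin-zero (σ ∷ S) z = trans (cong₂ (λ b y → b · cell σ ⊕ y) (z (here refl)) (lin-zero S (z ∘ there)))
  (⊕-self 𝟘)

cell-suc : ∀ {n} (σ : List (Fin n)) → cell (map suc σ) ≡ (cell σ , 𝟘)
cell-suc []      = refl
cell-suc (v ∷ σ) = trans (cong (ε (suc v)) (cell-suc σ)) (cong (cell (v ∷ σ) ,_) (ε-𝟘 v))

coef-suc : ∀ {n} τ (a b : Chain n) → coef (a , b) (map suc τ) ≡ coef a τ
coef-suc []      a b = refl
coef-suc (v ∷ τ) a b = coef-suc τ (ι v a) (ι v b)

·-pairˡ : ∀ {n} b (x : Chain n) → b · (x , 𝟘) ≡ (b · x , 𝟘)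
·-pairˡ true  x = refl
·-pairˡ false x = refl

·-pairʳ : ∀ {n} b (x : Chain n) → b · (𝟘 , x) ≡ (𝟘 , b · x)
·-pairʳ true  x = refl
·-pairʳ false x = refl

lin-subsets : ∀ n (x : Chain n) → lin (subsets n) (coef x) ≡ x
lin-subsets zero    true    = refl
lin-subsets zero    false   = refl
lin-subsets (suc n) (a , b) = trans (lin-++ (map (map suc) (subsets n)) _ _)
  (trans (cong₂ _⊕_ (without (subsets n)) (including (subsets n)))
    (cong₂ _,_ (trans (⊕-identityʳ _) (lin-subsets n a)) (trans (⊕-identityˡ _) (lin-subsets n b))))
  where
  without : ∀ S → lin (map (map suc) S) (coef (a , b)) ≡ (lin S (coef a) , 𝟘)
  without []      = refl
  without (σ ∷ S) = trans
    (cong₂ _⊕_ (trans (cong₂ _·_ (coef-suc σ a b) (cell-suc σ)) (·-pairˡ (coef a σ) (cell σ))) (without S))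
    (cong (lin (σ ∷ S) (coef a) ,_) (⊕-self 𝟘))
  including : ∀ S → lin (map (λ σ → zero ∷ map suc σ) S) (coef (a , b)) ≡ (𝟘 , lin S (coef b))
  including []      = refl
  including (σ ∷ S) = trans
    (cong₂ _⊕_ (trans (cong₂ _·_ (coef-suc σ b 𝟘) (cong (ε zero) (cell-suc σ))) (·-pairʳ (coef b σ) (cell σ)))
               (including S))
    (cong (_, lin (σ ∷ S) (coef b)) (⊕-self 𝟘))

filterᵇ-∈⁻ : ∀ {A : Set} (p : A → Bool) xs {x} → x ∈ filterᵇ p xs → x ∈ xs × p x ≡ true
filterᵇ-∈⁻ p (y ∷ xs) x∈ with p y in eq
... | false = let (q , r) = filterᵇ-∈⁻ p xs x∈ in there q , r
filterᵇ-∈⁻ p (y ∷ xs) (here refl) | true = here refl , eq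
filterᵇ-∈⁻ p (y ∷ xs) (there x∈)  | true = let (q , r) = filterᵇ-∈⁻ p xs x∈ in there q , r

lin-filter : ∀ {n} (p : List (Fin n) → Bool) S {w} → (∀ σ → p σ ≡ false → w σ ≡ false) →
  lin (filterᵇ p S) w ≡ lin S w
lin-filter p []      z = refl
lin-filter p (σ ∷ S) {w} z with p σ in eq
... | true  = cong (w σ · cell σ ⊕_) (lin-filter p S z)
... | false = trans (lin-filter p S z)
  (sym (trans (cong (λ b → b · cell σ ⊕ lin S w) (z σ eq)) (⊕-identityˡ _)))

lin-xor : ∀ {n} (S : List (List (Fin n))) v w → lin S (λ σ → v σ xor w σ) ≡ lin S v ⊕ lin S w
lin-xor []      v w = sym (⊕-self 𝟘)
lin-xor (σ ∷ S) v w = trans (cong₂ _⊕_ (·-xor (v σ) (w σ) (cell σ)) (lin-xor S v w))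
  (⊕-interchange (v σ · cell σ) _ _ _)

inner-comm : ∀ {C : Set} (cs : List C) f w → inner cs f w ≡ inner cs w f
inner-comm []       f w = refl
inner-comm (c ∷ cs) f w = cong₂ _xor_ (𝔹.∧-comm (f c) (w c)) (inner-comm cs f w)

module Additive {n : ℕ} (φ : Chain n → Bool) (add : ∀ x y → φ (x ⊕ y) ≡ φ x xor φ y) where

  φ-𝟘 : φ 𝟘 ≡ false
  φ-𝟘 = trans (cong φ (sym (⊕-self 𝟘))) (trans (add 𝟘 𝟘) (𝔹.xor-same (φ 𝟘)))

  φ-· : ∀ b x → φ (b · x) ≡ φ x ∧ b
  φ-· true  x = sym (𝔹.∧-identityʳ (φ x))
  φ-· false x = trans φ-𝟘 (sym (𝔹.∧-zeroʳ (φ x)))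

  φ-lin : ∀ S w → φ (lin S w) ≡ inner S (φ ∘ cell) w
  φ-lin []      w = φ-𝟘
  φ-lin (σ ∷ S) w = trans (add _ _) (cong₂ _xor_ (φ-· (w σ) (cell σ)) (φ-lin S w))

-- The functional is arbitrary so that the induction can pass from `φ` to `φ ∘ ε v`, which puts the
-- removed vertex `v` back.
φ-∂-cell : ∀ {n} (φ : Chain n → Bool) → (∀ x y → φ (x ⊕ y) ≡ φ x xor φ y) → ∀ σ →
  φ (∂ (cell σ)) ≡ expand (λ _ → true) (φ ∘ cell) σ
φ-∂-cell {n} φ add []      = trans (cong φ (∂-one n)) (Additive.φ-𝟘 φ add)
φ-∂-cell     φ add (v ∷ σ) = trans (cong φ (∂-ε v (cell σ))) (trans (add _ _)
  (cong (φ (cell σ) xor_) (φ-∂-cell (φ ∘ ε v) (λ x y → trans (cong φ (ε-⊕ v x y)) (add _ _)) σ)))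

bd₂ : ∀ {n} → List (Fin n) → List (Fin n) → Bool
bd₂ τ σ = expand (λ _ → true) (λ l → does (l ≟ˢ τ)) σ

residue-bd : ∀ {n} (τ σ : List (Fin n)) → Residue (bdCoeff τ σ) (bd₂ τ σ)
residue-bd τ σ = residue-expand _ _ _ σ (λ _ l _ → entry l)
  where
  entry : ∀ l → Residue (if does (l ≟ˢ τ) then 1ℚ else 0ℚ) (does (l ≟ˢ τ))
  entry l with does (l ≟ˢ τ)
  ... | true  = residue-1
  ... | false = residue-0

expand-cong-⊆ : ∀ {C : Set} (e : C → Bool) {F H} cs → (∀ {l} → l ⊆ cs → F l ≡ H l) →
  expand e F cs ≡ expand e H cs
expand-cong-⊆ e []       eq = refl
expand-cong-⊆ e (c ∷ cs) eq =
  cong₂ _xor_ (cong (e c ∧_) (eq (c ∷ʳ ⊆-refl))) (expand-cong-⊆ e cs (λ s → eq (refl ∷ s)))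

AllPairs-⊆ : ∀ {A : Set} {R : A → A → Set} {xs ys} → xs ⊆ ys → AllPairs R ys → AllPairs R xs
AllPairs-⊆ []         _        = []
AllPairs-⊆ (y ∷ʳ s)   (_ ∷ ps) = AllPairs-⊆ s ps
AllPairs-⊆ (refl ∷ s) (p ∷ ps) = Sublistₚ.All-resp-⊆ s p ∷ AllPairs-⊆ s ps

bd₂-coef : ∀ {n} {τ σ : List (Fin n)} → Sorted τ → Sorted σ → bd₂ τ σ ≡ coef (∂ (cell σ)) τ
bd₂-coef {τ = τ} {σ} sτ sσ = sym (trans (φ-∂-cell (λ x → coef x τ) (coef-⊕ τ) σ)
  (expand-cong-⊆ _ σ (λ s → coef-cell (AllPairs-⊆ s sσ) sτ)))

inner-delta : ∀ {n} (S : List (List (Fin n))) {τ} w → Unique S → τ ∈ S →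
  inner S (λ σ → does (σ ≟ˢ τ)) w ≡ w τ
inner-delta (σ ∷ S) {τ} w (σ∉ ∷ u) (here refl) = trans
  (cong₂ (λ b c → (b ∧ w τ) xor c) (dec-true (τ ≟ˢ τ) refl)
    (inner-zero S (λ {ρ} ρ∈ → cong (_∧ w ρ) (dec-false (ρ ≟ˢ τ) λ { refl → All.lookup σ∉ ρ∈ refl }))))
  (𝔹.xor-identityʳ (w τ))
inner-delta (σ ∷ S) {τ} w (σ∉ ∷ u) (there τ∈) = trans
  (cong (λ b → (b ∧ w σ) xor inner S (λ ρ → does (ρ ≟ˢ τ)) w)
    (dec-false (σ ≟ˢ τ) (All.lookup σ∉ τ∈)))
  (inner-delta S w u τ∈)

does-∧-true : ∀ {P : Set} {b} (p? : Dec P) → does p? ∧ b ≡ true → P × b ≡ true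
does-∧-true (yes p) eq = p , eq

does-∧-false : ∀ {P : Set} {b} (p? : Dec P) → does p? ∧ b ≡ false → ¬ P ⊎ b ≡ false
does-∧-false (yes p) eq = inj₂ eq
does-∧-false (no ¬p) eq = inj₁ ¬p

-- From Betti numbers to nonzero classes

module Homology {n : ℕ} (G : Graph n) where
  open Complex G

  V : VSet n
  V _ = true

  face? : ℕ → List (Fin n) → Bool
  face? s σ = does (length σ ℕ.≟ s) ∧ independent G σ

  faces-sorted : ∀ {s σ} → σ ∈ faces G s → Sorted σ
  faces-sorted {s} σ∈ = subsets-sorted n (proj₁ (filterᵇ-∈⁻ (face? s) (subsets n) σ∈))

  faces-unique : ∀ s → Unique (faces G s)
  faces-unique s = Uniqueₚ.filter⁺ (T? ∘ face? s) (subsets-unique n)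

  all-∈ : ∀ {A : Set} (p : A → Bool) {x} xs → all p xs ≡ true → x ∈ xs → p x ≡ true
  all-∈ p (y ∷ xs) eq x∈ with p y in py
  all-∈ p (y ∷ xs) eq (here refl) | true = py
  all-∈ p (y ∷ xs) eq (there x∈)  | true = all-∈ p xs eq x∈

  all-false : ∀ {A : Set} (p : A → Bool) xs → all p xs ≡ false → ∃ λ x → x ∈ xs × p x ≡ false
  all-false p (y ∷ xs) eq with p y in py
  ... | false = y , here refl , py
  ... | true  = let (x , x∈ , q) = all-false p xs eq in x , there x∈ , q

  Supp-cell : ∀ {W : VSet n} {σ} → Sorted σ → independent G σ ≡ true → (∀ {v} → v ∈ σ → W v ≡ true) →
    Supp W (cell σ)
  Supp-cell {W} {[]}    sσ ind σ⊆ = (λ u _ → ι-one u) , λ u w _ → trans (cong (ι u) (ι-one w)) (ι-𝟘 u)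
  Supp-cell {W} {v ∷ σ} sσ@(lt ∷ sσ′) ind σ⊆ with all (λ y → not (adj G v y)) σ in nb
  ... | true = Supp-ε v (σ⊆ (here refl)) (Supp-cell sσ′ ind λ {u} u∈ →
    ⊓-true⁺ {W = W} {lk v} (σ⊆ (there u∈)) (cong₂ _∧_
      (dl-≢ {u = u} {v} (λ { refl → head-∉ sσ u∈ })) (all-∈ (λ y → not (adj G v y)) σ nb u∈)))

  face-cell : ∀ {s σ} → σ ∈ faces G s → Supp V (cell σ) × π s (cell σ) ≡ cell σ
  face-cell {s} {σ} σ∈ with filterᵇ-∈⁻ (face? s) (subsets n) σ∈
  ... | p , q with does-∧-true (length σ ℕ.≟ s) q
  ...   | refl , ind = Supp-cell (subsets-sorted n p) ind (λ _ → refl) , π-cell σ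

  lin-faces : ∀ s S w → (∀ {σ} → σ ∈ S → σ ∈ faces G s) →
    Supp V (lin S w) × π s (lin S w) ≡ lin S w
  lin-faces s []      w S⊆ = Supp-𝟘 , π-𝟘 s
  lin-faces s (σ ∷ S) w S⊆ with lin-faces s S w (S⊆ ∘ there) | face-cell (S⊆ (here refl)) | w σ
  ... | p , q | f , g | true  = Supp-⊕ f p , trans (π-⊕ s _ _) (cong₂ _⊕_ g q)
  ... | p , q | f , g | false = subst (Supp V) (sym (⊕-identityˡ _)) p ,
    trans (cong (π s) (⊕-identityˡ _)) (trans q (sym (⊕-identityˡ _)))

  coef-dependent : ∀ {x} σ → (∀ u w → adj G u w ≡ true → ι u (ι w x) ≡ 𝟘) →
    independent G σ ≡ false → coef x σ ≡ false
  coef-dependent {x} (v ∷ σ) h dep with all (λ y → not (adj G v y)) σ in nb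
  ... | true  = coef-dependent σ (λ u w uw → trans (cong (ι u) (ι-comm w v x))
                  (trans (ι-comm u v _) (trans (cong (ι v) (h u w uw)) (ι-𝟘 v)))) dep
  ... | false with all-false (λ y → not (adj G v y)) σ nb
  ...   | y , y∈ , q = coef-ι {σ = σ} (ι v x) y∈ (trans (ι-comm y v x) (h v y (𝔹.not-injective q)))

  expansion : ∀ {s x} → Supp V x → π s x ≡ x → lin (faces G s) (coef x) ≡ x
  expansion {s} {x} (_ , h) hx = trans (lin-filter (face? s) (subsets n) off) (lin-subsets n x)
    where
    off : ∀ σ → face? s σ ≡ false → coef x σ ≡ false
    off σ eq with does-∧-false (length σ ℕ.≟ s) eq
    ... | inj₁ ne  = trans (cong (λ z → coef z σ) (sym hx)) (coef-π σ s x ne)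
    ... | inj₂ dep = coef-dependent σ h dep

  vanishes : ∀ {s x} → Supp V x → π s x ≡ x → (∀ {σ} → σ ∈ faces G s → coef x σ ≡ false) → x ≡ 𝟘
  vanishes {s} sx hx z = trans (sym (expansion sx hx)) (lin-zero (faces G s) z)

  coef-∂-lin : ∀ {s t τ} w → τ ∈ faces G t →
    coef (∂ (lin (faces G s) w)) τ ≡ inner (faces G s) (bd₂ τ) w
  coef-∂-lin {s} {t} {τ} w τ∈ = trans
    (Additive.φ-lin (λ x → coef (∂ x) τ) (λ x y → trans (cong (λ z → coef z τ) (∂-⊕ x y)) (coef-⊕ τ _ _))
      (faces G s) w)
    (inner-cong (faces G s) (λ σ∈ → sym (bd₂-coef (faces-sorted {t} τ∈) (faces-sorted {s} σ∈))) (λ _ → refl))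

  coef-lin : ∀ {s τ} w → τ ∈ faces G s → coef (lin (faces G s) w) τ ≡ w τ
  coef-lin {s} {τ} w τ∈ = trans (Additive.φ-lin (λ x → coef x τ) (coef-⊕ τ) (faces G s) w)
    (trans (inner-cong (faces G s) (λ σ∈ → coef-cell (faces-sorted {s} σ∈) (faces-sorted {s} τ∈)) (λ _ → refl))
           (inner-delta (faces G s) w (faces-unique s) τ∈))

  private
    P : ∀ s → Elimination.Pivots bd₂ (faces G (suc s)) (faces G s)
    P s = Elimination.pivots bd₂ (faces G (suc s)) (faces G s)

    pivot-rows : ℕ → List (List (Fin n))
    pivot-rows s = Elimination.Pivots.prows (P s)

  -- Equations that make a combination of faces a cycle. Pivot rows suffice, since they span all
  -- rows of the boundary matrix, and their number is at most the rational rank.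
  closing : ℕ → List (List (Fin n) → Bool)
  closing zero    = []
  closing (suc s) = map bd₂ (pivot-rows s)

  -- Equations that exclude nonzero boundaries: the values of a boundary at the pivot faces
  -- determine all its other values, so if they vanish it is zero.
  killing : ℕ → List (List (Fin n) → Bool)
  killing s = map (λ τ σ → does (σ ≟ˢ τ)) (pivot-rows s)

  rank-pivots : ∀ s → length (pivot-rows s) ≤ rankBd G (suc s)
  rank-pivots s = rank-≥ bdCoeff bd₂ residue-bd prows⊆ pcols⊆ square minor
    where open Elimination.Pivots (P s)

  closing-rank : ∀ s → length (closing s) ≤ rankBd G s
  closing-rank zero    = z≤n
  closing-rank (suc s) = subst (_≤ rankBd G (suc s)) (sym (length-map bd₂ (pivot-rows s))) (rank-pivots s)

  killing-rank : ∀ s → length (killing s) ≤ rankBd G (suc s)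
  killing-rank s = subst (_≤ rankBd G (suc s)) (sym (length-map _ (pivot-rows s))) (rank-pivots s)

  Kills : ℕ → (List (Fin n) → Bool) → List (List (Fin n) → Bool) → Set
  Kills s w φs = ∀ {φ} → φ ∈ φs → inner (faces G s) φ w ≡ false

  closed : ∀ s w → Kills s w (closing s) → ∂ (lin (faces G s) w) ≡ 𝟘
  closed s w k with lin-faces s (faces G s) w id
  closed zero w k    | sx , hx = trans (cong ∂ (sym hx)) (∂-π-zero _)
  closed (suc s) w k | sx , hx = vanishes {s} (Supp-∂ sx)
    (trans (sym (∂-π s _)) (cong ∂ hx))
    λ {τ} τ∈ → trans (coef-∂-lin {suc s} {s} w τ∈)
      (Elimination.Pivots.spanned (P s) τ∈ w (λ r∈ → k (∈-map⁺ bd₂ r∈)))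

  -- If the combination bounded some `y`, the pivot rows would vanish on `y` by `killing`, hence all
  -- rows, and `w` would be zero at `σ`.
  essential : ∀ s w → Kills s w (closing s) → Kills s w (killing s) →
    (∃ λ σ → σ ∈ faces G s × w σ ≡ true) → NonAcyclicᵍ s V × ¬ Bd V (lin (faces G s) w)
  essential s w kc kk (σ , σ∈ , wσ) with lin-faces s (faces G s) w id
  ... | sx , hx = (lin (faces G s) w , cyc sx (closed s w kc) , ¬bd , hx) , ¬bd
    where
    ¬bd : ¬ Bd V (lin (faces G s) w)
    ¬bd bd with Bd-π s bd hx
    ... | y , sy , ∂y , hy = contradiction (trans (sym wσ) (trans (sym (coef-lin {s} w σ∈)) (zero-coef σ∈))) λ ()
      where
      open Elimination.Pivots (P s)
      value : ∀ {τ} → τ ∈ faces G s → inner (faces G (suc s)) (bd₂ τ) (coef y) ≡ coef (lin (faces G s) w) τ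
      value {τ} τ∈ = trans (sym (coef-∂-lin {suc s} {s} (coef y) τ∈))
        (cong (λ z → coef z τ) (trans (cong ∂ (expansion sy hy)) ∂y))
      pivot-zero : ∀ {τ} → τ ∈ prows → inner (faces G (suc s)) (bd₂ τ) (coef y) ≡ false
      pivot-zero {τ} τ∈ = trans (value τ∈′) (trans (coef-lin {s} w τ∈′)
        (trans (sym (inner-delta (faces G s) w (faces-unique s) τ∈′))
               (kk (∈-map⁺ (λ τ σ → does (σ ≟ˢ τ)) τ∈))))
        where
        τ∈′ : τ ∈ faces G s
        τ∈′ = Sublist.lookup prows⊆ τ∈
      zero-coef : ∀ {τ} → τ ∈ faces G s → coef (lin (faces G s) w) τ ≡ false
      zero-coef τ∈ = trans (sym (value τ∈)) (spanned τ∈ (coef y) pivot-zero)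

  constraints : ℕ → List (List (Fin n) → Bool)
  constraints s = closing s ++ killing s

  -- The equations number at most the two ranks subtracted in the Betti number, so `b` further ones
  -- still leave fewer equations than unknowns.
  constraints-bound : ∀ s b → b < bettiBySize G s → b + length (constraints s) < length (faces G s)
  constraints-bound s b lt = begin-strict
    b + length (constraints s)                       ≡⟨ cong (b ℕ.+_) (length-++ (closing s)) ⟩
    b + (length (closing s) + length (killing s))    ≤⟨ ℕₚ.+-monoʳ-≤ b (ℕₚ.+-mono-≤ (closing-rank s) (killing-rank s)) ⟩
    b + (rankBd G s + rankBd G (suc s))              <⟨ ℕₚ.≰⇒> (λ le → ℕₚ.<⇒≱ lt (subst (_≤ b) (sym (ℕₚ.∸-+-assoc (length (faces G s)) (rankBd G s) (rankBd G (suc s))))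
          (ℕₚ.m≤n+o⇒m∸n≤o _ _ (ℕₚ.≤-trans le (ℕₚ.≤-reflexive (ℕₚ.+-comm b _)))))) ⟩
    length (faces G s)                               ∎
    where open ℕₚ.≤-Reasoning

  solution : ∀ s φs → length φs + length (constraints s) < length (faces G s) →
    Solution _≟ˢ_ (faces G s) (φs ++ constraints s)
  solution s φs lt = kernel _≟ˢ_ (faces G s) (φs ++ constraints s) (faces-unique s)
    (subst (_< length (faces G s)) (sym (length-++ φs)) lt)

  killed : ∀ {s w} ψs → Kills s w (ψs ++ constraints s) → Kills s w (closing s) × Kills s w (killing s)
  killed {s} ψs k = (λ φ∈ → k (∈-++⁺ʳ ψs (∈-++⁺ˡ φ∈))) , (λ φ∈ → k (∈-++⁺ʳ ψs (∈-++⁺ʳ (closing s) φ∈)))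

  Kills-xor : ∀ {s v w φs} → Kills s v φs → Kills s w φs → Kills s (λ σ → v σ xor w σ) φs
  Kills-xor {s} {v} {w} kv kw {φ} φ∈ = trans (inner-comm (faces G s) φ _)
    (trans (inner-xor (faces G s) v w φ) (xor-false
      (trans (inner-comm (faces G s) v φ) (kv φ∈)) (trans (inner-comm (faces G s) w φ) (kw φ∈))))

  betti-NonAcyclic : ∀ s → 0 < bettiBySize G s → NonAcyclicᵍ s V
  betti-NonAcyclic s lt with solution s [] (constraints-bound s 0 lt)
  ... | w , nz , k = let (kc , kk) = killed {s} [] k in proj₁ (essential s w kc kk nz)

  -- A Betti number above 1 leaves room for two solutions `v` and `w` such that `v`, `w` and their
  -- sum are all nonzero, hence all essential.
  betti≤1 : Rank≤1 V → ∀ s → bettiBySize G s ≤ 1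
  betti≤1 p1 s = ℕₚ.≮⇒≥ λ lt → refute lt
    where
    refute : ¬ 1 < bettiBySize G s
    refute lt with solution s [] (ℕₚ.<-trans (ℕₚ.n<1+n _) (constraints-bound s 1 lt))
    ... | v , nz@(σ , σ∈ , vσ) , kv
      -- The extra equation makes `w` vanish at a face `σ` where `v` does not, so their sum is
      -- nonzero there.
      with solution s ((λ ρ → does (ρ ≟ˢ σ)) ∷ []) (constraints-bound s 1 lt)
    ...   | w , nz′ , kw with killed {s} [] kv | killed {s} (_ ∷ []) kw
    ...     | vc , vk | wc , wk = conclude (p1 _ _ (cycle vc) (cycle wc))
      where
      cycle : ∀ {u} → Kills s u (closing s) → Cycle V (lin (faces G s) u)
      cycle {u} k = cyc (proj₁ (lin-faces s (faces G s) u id)) (closed s u k)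
      wσ : w σ ≡ false
      wσ = trans (sym (inner-delta (faces G s) w (faces-unique s) σ∈)) (kw (here refl))
      conclude : Bd V (lin (faces G s) v) ⊎ Bd V (lin (faces G s) w) ⊎
                 Bd V (lin (faces G s) v ⊕ lin (faces G s) w) → ⊥
      conclude (inj₁ p)        = proj₂ (essential s v vc vk nz) p
      conclude (inj₂ (inj₁ p)) = proj₂ (essential s w wc wk nz′) p
      conclude (inj₂ (inj₂ p)) = proj₂ (essential s _ (Kills-xor vc wc) (Kills-xor vk wk)
        (σ , σ∈ , cong₂ _xor_ vσ wσ)) (subst (Bd V) (sym (lin-xor (faces G s) v w)) p)

  betti-exclusive : Rank≤1 V → ∀ s t → s ≢ t → bettiBySize G s ≡ 0 ⊎ bettiBySize G t ≡ 0
  betti-exclusive p1 s t ne with bettiBySize G s in bs | bettiBySize G t in bt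
  ... | zero  | _     = inj₁ refl
  ... | suc _ | zero  = inj₂ refl
  ... | suc _ | suc _ = contradiction (Rank≤1-unique p1
    (betti-NonAcyclic s (subst (0 <_) (sym bs) (s≤s z≤n))) (betti-NonAcyclic t (subst (0 <_) (sym bt) (s≤s z≤n)))) ne

-- The total Betti number

sum-zero : ∀ (f : ℕ → ℕ) {xs} → All (λ x → f x ≡ 0) xs → sum (map f xs) ≡ 0
sum-zero f []       = refl
sum-zero f (p ∷ ps) = cong₂ _+_ p (sum-zero f ps)

sum-≤1 : ∀ (f : ℕ → ℕ) → (∀ s → f s ≤ 1) → (∀ s t → s ≢ t → f s ≡ 0 ⊎ f t ≡ 0) →
  ∀ {xs} → Unique xs → sum (map f xs) ≤ 1
sum-≤1 f h ex [] = z≤n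
sum-≤1 f h ex (_∷_ {x} {xs} x∉ u) with f x in eq
... | zero  = sum-≤1 f h ex u
... | suc m = subst (λ k → suc m + k ≤ 1) (sym (sum-zero f (All.map other x∉)))
  (subst (_≤ 1) (trans eq (sym (ℕₚ.+-identityʳ (suc m)))) (h x))
  where
  other : ∀ {y} → x ≢ y → f y ≡ 0
  other {y} ne with ex x y ne
  ... | inj₂ q = q
  ... | inj₁ q = contradiction (trans (sym eq) q) λ ()

theorem2 : ∀ {n : ℕ} (G : Graph n) →
    (∀ k → 3 ∣ k → ¬ InducedCycle G k) →
    totalBetti G ≤ 1
theorem2 {n} G ternary = sum-≤1 (bettiBySize G) (betti≤1 p1) (betti-exclusive p1) (Uniqueₚ.upTo⁺ (suc n))
  where
  open Homology G
  p1 : Complex.Rank≤1 G V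
  p1 = ternary⇒Rank≤1 G ternary V
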